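{- Let $3\leq m\leq n$ be integers. Then the number $p_{m,n}$ of inequivalent integer $m$-gons with perimeter $n$ is \[ p_{m,n} = \sum_{d\mid \gcd(m,n)}\frac{\varphi(d)}{2n}\binom{n/d}{m/d} +\frac12 \left( \binom{\lfloor m/2\rfloor+\lfloor (n-m)/2\rfloor}{\lfloor m/2\rfloor} - \binom{\lfloor n/2\rfloor}{m-1} - \binom{\lfloor n/4\rfloor}{\lfloor m/2\rfloor} - \binom{\lfloor (n+2)/4\rfloor}{m/2} \right). \]
   Context: An integer $m$-gon is a polygon with $m$ sides whose side lengths are all positive integers; its perimeter is the sum of the side lengths. Reading the side lengths of an $m$-gon starting from any side, clockwise or anticlockwise, gives an $m$-tuple $(a_1,\dots,a_m)$; two $m$-gons are equivalent if the $m$-tuple of one can be obtained from that of the other by cyclically re-ordering and/or reversing the entries. (The side-length tuples of integer $m$-gons of perimeter $n$ are exactly the $m$-tuples of positive integers summing to $n$ with every entry less than $n/2$.) $\varphi$ is Euler's totient function, $\lfloor x\rfloor$ is the floor. Convention: a binomial coefficient $\binom{a}{b}$ has its usual meaning when $a,b$ are non-negative integers with $b\leq a$, and is $0$ otherwise (in particular it is $0$ when $b$ is not an integer, e.g. $\binom{x}{m/2}=0$ for odd $m$). -}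

module Defs where

open import Data.Nat using (ℕ; zero; suc; _+_; _*_; _∸_; _<_; _≤_; NonZero)
open import Data.Nat.DivMod using (_/_; _%_)
open import Data.Nat.Divisibility using (_∣?_)
open import Data.Nat.GCD using (gcd)
open import Data.Nat.Combinatorics using (_C_)
open import Data.Nat.Properties using (_≟_)
open import Data.Integer as ℤ using (ℤ; +_)
open import Data.Rational as ℚ using (ℚ)
open import Data.List using (List; []; _∷_; length; drop; take; _++_; reverse; filter; upTo; map; foldr)
open import Data.Nat.ListAction using (sum)
open import Data.List.Relation.Unary.All using (All)
open import Data.List.Relation.Unary.Any using (Any)
open import Data.List.Relation.Unary.AllPairs using (AllPairs)
open import Data.Product using (_×_; ∃-syntax)
open import Data.Sum using (_⊎_)
open import Relation.Binary.PropositionalEquality using (_≡_)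
open import Relation.Nullary using (¬_)

-- a side-length tuple of an integer m-gon of perimeter n:
-- m positive integers summing to n, each less than n/2 (i.e. 2a < n)
IsPolygonTuple : ℕ → ℕ → List ℕ → Set
IsPolygonTuple m n xs =
  length xs ≡ m × All (λ a → 1 ≤ a × 2 * a < n) xs × sum xs ≡ n

rotate : ℕ → List ℕ → List ℕ
rotate k xs = drop k xs ++ take k xs

Equiv : List ℕ → List ℕ → Set
Equiv xs ys = ∃[ k ] (ys ≡ rotate k xs ⊎ ys ≡ reverse (rotate k xs))

IsTransversal : ℕ → ℕ → List (List ℕ) → Set
IsTransversal m n reps =
  All (IsPolygonTuple m n) reps
  × AllPairs (λ xs ys → ¬ Equiv xs ys) reps
  × (∀ xs → IsPolygonTuple m n xs → Any (Equiv xs) reps)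

φ : ℕ → ℕ
φ d = length (filter (λ k → gcd k d ≟ 1) (map suc (upTo d)))

-- binomial coefficient with a half-integer lower index:
-- binomHalf x m = C(x, m/2) if m even, 0 if m odd
binomHalf : ℕ → ℕ → ℕ
binomHalf x m with m % 2
... | zero = x C (m / 2)
... | suc _ = 0

-- a / k as a rational (k = 0 never occurs in the theorem, where k = 2n, n ≥ 3)
frac : ℤ → ℕ → ℚ
frac a zero = ℚ.0ℚ
frac a (suc k) = a ℚ./ suc k

divisorSum : ℕ → ℕ → ℕ
divisorSum m n = foldr (λ k acc → term (suc k) + acc) 0 (upTo (gcd m n))
  where
  term : (d : ℕ) → .{{NonZero d}} → ℕ
  term d with d ∣? gcd m n
  ... | Relation.Nullary.yes _ = φ d * ((n / d) C (m / d))
  ... | Relation.Nullary.no _ = 0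

formula : ℕ → ℕ → ℚ
formula m n =
  frac (+ divisorSum m n) (2 * n)
  ℚ.+ frac ( + ((m / 2 + (n ∸ m) / 2) C (m / 2))
           ℤ.- + ((n / 2) C (m ∸ 1))
           ℤ.- + ((n / 4) C (m / 2))
           ℤ.- + binomHalf ((n + 2) / 4) m ) 2

{-# OPTIONS --safe #-}

-- Burnside's lemma for the dihedral group generated by ρ (rotation by one side) and τ (reversal),
-- acting on the polygon tuples: 2m · #orbits = Σₖ #Fix(ρᵏ) + Σₖ #Fix(τρᵏ), k < m.
--
-- A composition of n into m parts fixed by ρᵏ is a block of length gcd(k,m) repeated d = m/gcd(k,m)
-- times, which gives Σ φ(d) C(n/d−1, m/d−1) = (m/n) Σ φ(d) C(n/d, m/d). A composition that is not a
-- polygon has exactly one part ≥ n/2, so it is fixed by the identity only, and there are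
-- m C(⌊n/2⌋, m−1) of these.
--
-- τρᵏ and τρᵏ⁺² are conjugate. For m = 2h+1 only Fix(τ) matters: a polygon in it is determined by
-- half of its sides, of sum s, with 2s < n < 4s. For m = 2h, a polygon in Fix(τρ) has two sides x, c
-- on the axis and h−1 sides of sum s between them; those with x = c correspond to Fix(τ), the others
-- in pairs to compositions (c, …) with 2(c+s) < n < 2c+4s, so #Fix(τ) + #Fix(τρ) is twice the number
-- of compositions into h parts with 2(c+s) ≤ n < 2c+4s. The parity of c counts those with 2c+4s ≤ n.

module Submission where

open import Defs
open import Data.Bool using (if_then_else_)
open import Data.Empty using (⊥; ⊥-elim)
open import Data.Integer as ℤ using (ℤ) renaming (+_ to pos)
import Data.Integer.Properties as ℤₚ
import Data.Integer.Tactic.RingSolver as ℤ-Solver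
open import Data.List using (List; []; _∷_; [_]; length; map; filter; foldr; upTo; applyUpTo; drop; take; _++_; _∷ʳ_; reverse; concat; replicate)
open import Data.List.Membership.Propositional using (_∈_; find)
open import Data.List.Membership.Propositional.Properties using (∈-map⁺; ∈-map⁻; ∈-++⁺ˡ; ∈-++⁺ʳ; ∈-++⁻; ∈-filter⁺; ∈-filter⁻; ∈-upTo⁺; ∈-upTo⁻; ∈-∃++)
open import Data.List.Membership.Propositional.Properties.WithK using (unique∧set⇒bag)
open import Data.List.Properties using (≡-dec; map-∘; map-++; map-upTo; upTo-∷ʳ; length-map; length-++; length-upTo; length-take; length-drop; length-reverse; ++-identityʳ; ++-assoc; ∷ʳ-++; take++drop≡id; drop-all; take-all; reverse-++; unfold-reverse; reverse-involutive; ∷-injectiveˡ; ∷-injectiveʳ)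
open import Data.List.Relation.Binary.BagAndSetEquality using (∼bag⇒↭)
open import Data.List.Relation.Binary.Permutation.Propositional using (_↭_; ↭-sym; ↭-refl)
open import Data.List.Relation.Binary.Permutation.Propositional.Properties using (↭-length; All-resp-↭; ↭-reverse; ∷↭∷ʳ; shift) renaming (map⁺ to ↭-map⁺)
open import Data.List.Relation.Unary.All as All using (All; []; _∷_)
import Data.List.Relation.Unary.All.Properties as Allₚ
open import Data.List.Relation.Unary.AllPairs as AllPairs using (AllPairs; []; _∷_)
open import Data.List.Relation.Unary.Any as Any using (Any; here; there)
open import Data.List.Relation.Unary.Unique.Propositional using (Unique)
import Data.List.Relation.Unary.Unique.Propositional.Properties as Uniqueₚ
open import Data.Nat using (ℕ; zero; suc; pred; _+_; _*_; _∸_; _≤_; _<_; z≤n; s≤s; s≤s⁻¹; _≟_; _≤?_; _<?_; NonZero; >-nonZero)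
open import Data.Nat.Combinatorics using (_C_; nCk+nC[k+1]≡[n+1]C[k+1])
open import Data.Nat.Combinatorics.Specification using (k>n⇒nCk≡0)
open import Data.Nat.DivMod using (_/_; m/n*n≤m; /-monoˡ-≤; m*n/n≡m; m*n%n≡0; [m+kn]%n≡m%n; +-distrib-/-∣ʳ; [m∸n*o]/o≡m/o∸n)
open import Data.Nat.Divisibility using (_∣_; divides; _∣?_; ∣⇒≤; ∣-trans; n/m≡quotient)
open import Data.Nat.GCD using (gcd; gcd[m,n]∣m; gcd[m,n]∣n; gcd-greatest; gcd-GCD; module Bézout; c*gcd[m,n]≡gcd[cm,cn]; gcd[m,n]≡0⇒m≡0)
open import Data.Nat.ListAction using (sum)
open import Data.Nat.ListAction.Properties using (sum-↭; sum-++)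
open import Data.Nat.Properties hiding (_≟_; _≤?_; _<?_)
open import Algebra.Properties.CommutativeSemigroup +-commutativeSemigroup using (interchange)
open import Data.Nat.Tactic.RingSolver using (solve-∀)
open import Data.Product using (_×_; _,_; proj₁; proj₂; ∃-syntax; Σ-syntax)
import Data.Rational as ℚ
open import Data.Rational.Properties using (toℚᵘ-injective; toℚᵘ-homo-+; toℚᵘ-fromℚᵘ)
open import Data.Rational.Unnormalised as ℚᵘ using (mkℚᵘ; *≡*)
import Data.Rational.Unnormalised.Properties as ℚᵘₚ
open import Data.Sum using (_⊎_; inj₁; inj₂; [_,_]′)
open import Function using (_∘_; id)
open import Function.Bundles using (mk⇔)
open import Relation.Binary using (DecidableEquality; tri<; tri≈; tri>)
open import Relation.Binary.PropositionalEquality using (_≡_; _≢_; refl; sym; trans; cong; cong₂; subst; module ≡-Reasoning)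
open import Relation.Nullary using (¬_; Dec; yes; no; does; contradiction)
open import Relation.Nullary.Decidable using (_×-dec_)
open import Relation.Unary using (Decidable)

-- Burnside's lemma comes from a double count of the words ρᵏ and τρᵏ, k < m, that carry one tuple
-- to another. Different words may act alike, so no group, stabilizer or quotient is ever formed.
-- Three of the four binomials outside the divisor sum carry a minus sign; each count is therefore
-- stated additively in ℕ, with the exceptional tuples moved to the other side, and signs appear
-- only in the passage to ℚ. The divisor sum counts all compositions, and its excess over the
-- polygons sits in the term d = 1 alone: two or more equal blocks with at least three sides in all
-- leave no side as long as half of the perimeter. For even m the two kinds of reflection are
-- counted jointly, because equality in 2(c+s) ≤ n occurs for even n only and is supplied by Fix(τ);
-- joined to the strict case it gives the floor of n/2 with no distinction of parity.

private variable
  A B : Set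

-- Finite sums

∑ : List A → (A → ℕ) → ℕ
∑ xs f = sum (map f xs)

syntax ∑ xs (λ x → e) = ∑[ x ∈ xs ] e

infix 8 ∑

∑-cong : ∀ (xs : List A) {f g : A → ℕ} → (∀ {x} → x ∈ xs → f x ≡ g x) → ∑ xs f ≡ ∑ xs g
∑-cong []       eq = refl
∑-cong (x ∷ xs) eq = cong₂ _+_ (eq (here refl)) (∑-cong xs (eq ∘ there))

∑-zero : ∀ (xs : List A) {f : A → ℕ} → (∀ {x} → x ∈ xs → f x ≡ 0) → ∑ xs f ≡ 0
∑-zero []       eq = refl
∑-zero (x ∷ xs) eq = cong₂ _+_ (eq (here refl)) (∑-zero xs (eq ∘ there))

∑-+ : ∀ (xs : List A) (f g : A → ℕ) → ∑[ x ∈ xs ] (f x + g x) ≡ ∑ xs f + ∑ xs g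
∑-+ []       f g = refl
∑-+ (x ∷ xs) f g = trans (cong (f x + g x +_) (∑-+ xs f g)) (interchange (f x) (g x) (∑ xs f) (∑ xs g))

∑-*ˡ : ∀ (xs : List A) c (f : A → ℕ) → ∑[ x ∈ xs ] (c * f x) ≡ c * ∑ xs f
∑-*ˡ []       c f = sym (*-zeroʳ c)
∑-*ˡ (x ∷ xs) c f = trans (cong (c * f x +_) (∑-*ˡ xs c f)) (sym (*-distribˡ-+ c (f x) _))

∑-const : ∀ (xs : List A) c → ∑[ x ∈ xs ] c ≡ length xs * c
∑-const []       c = refl
∑-const (x ∷ xs) c = cong (c +_) (∑-const xs c)

∑-swap : ∀ (xs : List A) (ys : List B) (f : A → B → ℕ) →
         ∑[ x ∈ xs ] (∑[ y ∈ ys ] f x y) ≡ ∑[ y ∈ ys ] (∑[ x ∈ xs ] f x y)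
∑-swap []       ys f = sym (∑-zero ys (λ _ → refl))
∑-swap (x ∷ xs) ys f =
  trans (cong (∑ ys (f x) +_) (∑-swap xs ys f)) (sym (∑-+ ys (f x) _))

∑-upTo-suc : ∀ m (f : ℕ → ℕ) → ∑ (upTo (suc m)) f ≡ f 0 + ∑ (upTo m) (f ∘ suc)
∑-upTo-suc m f = cong (λ l → f 0 + sum l) (begin
  map f (applyUpTo suc m)    ≡⟨ cong (map f) (sym (map-upTo suc m)) ⟩
  map f (map suc (upTo m))   ≡⟨ sym (map-∘ (upTo m)) ⟩
  map (f ∘ suc) (upTo m)     ∎)
  where open ≡-Reasoning

∑-upTo-last : ∀ m (f : ℕ → ℕ) → ∑ (upTo (suc m)) f ≡ ∑ (upTo m) f + f m
∑-upTo-last m f = begin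
  ∑ (upTo (suc m)) f                 ≡⟨ cong (λ l → ∑ l f) (sym (upTo-∷ʳ m)) ⟩
  sum (map f (upTo m ++ [ m ]))      ≡⟨ cong sum (map-++ f (upTo m) [ m ]) ⟩
  sum (map f (upTo m) ++ [ f m ])    ≡⟨ sum-++ (map f (upTo m)) [ f m ] ⟩
  ∑ (upTo m) f + (f m + 0)           ≡⟨ cong (∑ (upTo m) f +_) (+-identityʳ (f m)) ⟩
  ∑ (upTo m) f + f m                 ∎
  where open ≡-Reasoning

∑-shift : ∀ m (f : ℕ → ℕ) → f m ≡ f 0 → ∑ (upTo m) (f ∘ suc) ≡ ∑ (upTo m) f
∑-shift m f eq = +-cancelˡ-≡ (f 0) _ _ (begin
  f 0 + ∑ (upTo m) (f ∘ suc) ≡⟨ sym (∑-upTo-suc m f) ⟩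
  ∑ (upTo (suc m)) f         ≡⟨ ∑-upTo-last m f ⟩
  ∑ (upTo m) f + f m         ≡⟨ +-comm _ (f m) ⟩
  f m + ∑ (upTo m) f         ≡⟨ cong (_+ ∑ (upTo m) f) eq ⟩
  f 0 + ∑ (upTo m) f         ∎)
  where open ≡-Reasoning

⟦_⟧ : {X : Set} → Dec X → ℕ
⟦ d ⟧ = if does d then 1 else 0

⟦⟧-yes : {X : Set} (d : Dec X) → X → ⟦ d ⟧ ≡ 1
⟦⟧-yes (yes _) x = refl
⟦⟧-yes (no ¬x) x = ⊥-elim (¬x x)

⟦⟧-no : {X : Set} (d : Dec X) → ¬ X → ⟦ d ⟧ ≡ 0
⟦⟧-no (yes x) ¬x = ⊥-elim (¬x x)
⟦⟧-no (no _)  ¬x = refl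

∑-filter : {Q : A → Set} (Q? : Decidable Q) (xs : List A) → ∑[ x ∈ xs ] ⟦ Q? x ⟧ ≡ length (filter Q? xs)
∑-filter Q? []       = refl
∑-filter Q? (x ∷ xs) with Q? x
... | yes _ = cong suc (∑-filter Q? xs)
... | no  _ = ∑-filter Q? xs

∑-unique : {Q : A → Set} (Q? : Decidable Q) {xs : List A} {a : A} → Unique xs → a ∈ xs → Q a →
           (∀ {x} → x ∈ xs → Q x → x ≡ a) → (f : A → ℕ) → ∑[ x ∈ xs ] (⟦ Q? x ⟧ * f x) ≡ f a
∑-unique Q? {x ∷ xs} (x∉ ∷ u) (here refl) qa only f = begin
  ⟦ Q? x ⟧ * f x + ∑[ y ∈ xs ] (⟦ Q? y ⟧ * f y)
    ≡⟨ cong₂ _+_ (cong (_* f x) (⟦⟧-yes (Q? x) qa)) (∑-zero xs λ {y} y∈ → cong (_* f y) (⟦⟧-no (Q? y) λ qy → All.lookup x∉ y∈ (sym (only (there y∈) qy)))) ⟩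
  1 * f x + 0 ≡⟨ trans (+-identityʳ _) (*-identityˡ _) ⟩
  f x ∎
  where open ≡-Reasoning
∑-unique Q? {x ∷ xs} (x∉ ∷ u) (there a∈) qa only f = cong₂ _+_
  (cong (_* f x) (⟦⟧-no (Q? x) λ qx → All.lookup x∉ a∈ (only (here refl) qx)))
  (∑-unique Q? u a∈ qa (only ∘ there) f)

-- Cardinalities of finite predicates

-- Sizes are carried by explicit repetition-free enumerations, since Burnside's lemma also sums over
-- the members. A predicate in place of a subtype lets members be compared without comparing proofs
-- of `P`.
record Card {A : Set} (P : A → Set) (N : ℕ) : Set where
  field
    elems    : List A
    unique   : Unique elems
    sound    : ∀ {x} → x ∈ elems → P x
    complete : ∀ {x} → P x → x ∈ elems
    size     : length elems ≡ N

open Card public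

infix 3 _≃_

-- The maps are total but inverse to each other only on members, so that `take h`, `pred` or
-- truncated subtraction can serve as inverses.
record _≃_ {A B : Set} (P : A → Set) (Q : B → Set) : Set where
  field
    to      : A → B
    from    : B → A
    to-∈    : ∀ {x} → P x → Q (to x)
    from-∈  : ∀ {y} → Q y → P (from y)
    from-to : ∀ {x} → P x → from (to x) ≡ x
    to-from : ∀ {y} → Q y → to (from y) ≡ y

⇔⇒≃ : {P Q : A → Set} → (∀ {x} → P x → Q x) → (∀ {x} → Q x → P x) → P ≃ Q
⇔⇒≃ f g = record { to = id ; from = id ; to-∈ = f ; from-∈ = g ; from-to = λ _ → refl ; to-from = λ _ → refl }

≃-sym : ∀ {P : A → Set} {Q : B → Set} → P ≃ Q → Q ≃ P
≃-sym e = record { to = from ; from = to ; to-∈ = from-∈ ; from-∈ = to-∈ ; from-to = to-from ; to-from = from-to }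
  where open _≃_ e

map-unique : {f : A → B} {xs : List A} → (∀ {x y} → x ∈ xs → y ∈ xs → f x ≡ f y → x ≡ y) →
             Unique xs → Unique (map f xs)
map-unique inj []       = []
map-unique inj (x∉ ∷ u) =
  Allₚ.map⁺ (All.tabulate λ y∈ eq → All.lookup x∉ y∈ (inj (here refl) (there y∈) eq))
  ∷ map-unique (λ x∈ y∈ → inj (there x∈) (there y∈)) u

card-≃ : ∀ {P : A → Set} {Q : B → Set} {N} → P ≃ Q → Card P N → Card Q N
card-≃ {Q = Q} e c = record
  { elems    = map to (elems c)
  ; unique   = map-unique (λ x∈ y∈ eq → trans (sym (from-to (sound c x∈))) (trans (cong from eq) (from-to (sound c y∈)))) (unique c)
  ; sound    = λ y∈ → let (x , x∈ , eq) = ∈-map⁻ to y∈ in subst Q (sym eq) (to-∈ (sound c x∈))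
  ; complete = λ q → subst (_∈ map to (elems c)) (to-from q) (∈-map⁺ to (complete c (from-∈ q)))
  ; size     = trans (length-map to (elems c)) (size c)
  }
  where open _≃_ e

enum-↭ : ∀ {P : A → Set} {M N} (c : Card P M) (d : Card P N) → elems c ↭ elems d
enum-↭ c d = ∼bag⇒↭ (unique∧set⇒bag (unique c) (unique d) (mk⇔ (complete d ∘ sound c) (complete c ∘ sound d)))

card-unique : ∀ {P : A → Set} {M N} → Card P M → Card P N → M ≡ N
card-unique c d = trans (sym (size c)) (trans (↭-length (enum-↭ c d)) (size d))

∑-enum : ∀ {P : A → Set} {M N} (c : Card P M) (d : Card P N) (f : A → ℕ) → ∑ (elems c) f ≡ ∑ (elems d) f
∑-enum c d f = sum-↭ (↭-map⁺ f (enum-↭ c d))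

card-∪ : ∀ {P Q : A → Set} {M N} → (∀ {x} → P x → Q x → ⊥) → Card P M → Card Q N → Card (λ x → P x ⊎ Q x) (M + N)
card-∪ disj c d = record
  { elems    = elems c ++ elems d
  ; unique   = Uniqueₚ.++⁺ (unique c) (unique d) (λ (x∈ , y∈) → disj (sound c x∈) (sound d y∈))
  ; sound    = λ x∈ → [ inj₁ ∘ sound c , inj₂ ∘ sound d ]′ (∈-++⁻ (elems c) x∈)
  ; complete = [ ∈-++⁺ˡ ∘ complete c , ∈-++⁺ʳ (elems c) ∘ complete d ]′
  ; size     = trans (length-++ (elems c)) (cong₂ _+_ (size c) (size d))
  }

card-∅ : {P : A → Set} → (∀ {x} → ¬ P x) → Card P 0
card-∅ ¬p = record { elems = [] ; unique = [] ; sound = λ () ; complete = ⊥-elim ∘ ¬p ; size = refl }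

card-filter : ∀ {P Q : A → Set} {N} (c : Card P N) (Q? : Decidable Q) → Card (λ x → P x × Q x) (∑[ x ∈ elems c ] ⟦ Q? x ⟧)
card-filter c Q? = record
  { elems    = filter Q? (elems c)
  ; unique   = Uniqueₚ.filter⁺ Q? (unique c)
  ; sound    = λ x∈ → let (x∈c , q) = ∈-filter⁻ Q? x∈ in sound c x∈c , q
  ; complete = λ (p , q) → ∈-filter⁺ Q? (complete c p) q
  ; size     = sym (∑-filter Q? (elems c))
  }

-- Compositions

-- Pascal's rule splits the left side, and the two induction hypotheses recombine by the same rule.
-- This trades C(n/d - 1, m/d - 1), the count of fixed compositions, for the C(n/d, m/d) of the
-- formula.
absorption : ∀ n k → suc k * (suc n C suc k) ≡ suc n * (n C k)
absorption zero    zero    = refl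
absorption zero    (suc k) = trans (cong (suc (suc k) *_) (k>n⇒nCk≡0 {1} {suc (suc k)} (s≤s (s≤s z≤n))))
                      (trans (*-zeroʳ (suc (suc k))) (sym (trans (*-identityˡ _) (k>n⇒nCk≡0 {0} {suc k} (s≤s z≤n)))))
absorption (suc n) zero    = trans (*-identityˡ _) (trans (sym (nCk+nC[k+1]≡[n+1]C[k+1] (suc n) 0))
  (cong suc (trans (sym (*-identityˡ _)) (absorption n 0))))
absorption (suc n) (suc k) = begin
  suc (suc k) * (suc (suc n) C suc (suc k))
    ≡⟨ cong (suc (suc k) *_) (sym (nCk+nC[k+1]≡[n+1]C[k+1] (suc n) (suc k))) ⟩
  suc (suc k) * (a + b)                ≡⟨ step₁ k a b ⟩
  a + (suc k * a + suc (suc k) * b)    ≡⟨ cong (a +_) (cong₂ _+_ (absorption n k) (absorption n (suc k))) ⟩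
  a + (suc n * (n C k) + suc n * (n C suc k)) ≡⟨ cong (a +_) (sym (*-distribˡ-+ (suc n) (n C k) _)) ⟩
  a + suc n * (n C k + n C suc k)      ≡⟨ cong (λ t → a + suc n * t) (nCk+nC[k+1]≡[n+1]C[k+1] n k) ⟩
  suc (suc n) * a ∎
  where
  open ≡-Reasoning
  a = suc n C suc k
  b = suc n C suc (suc k)
  step₁ : ∀ k a b → suc (suc k) * (a + b) ≡ a + (suc k * a + suc (suc k) * b)
  step₁ = solve-∀

-- A first part equal to 1 is removed, a larger one is lowered by 1. The recursion has the shape of
-- Pascal's rule and is correct at h = 0 and s = 0, where C(s - 1, h - 1) would meet truncated
-- subtraction.
compositions : ℕ → ℕ → ℕ
compositions zero    zero    = 1
compositions zero    (suc s) = 0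
compositions (suc h) zero    = 0
compositions (suc h) (suc s) = compositions h s + compositions (suc h) s

compositions≡C : ∀ h s → compositions (suc h) (suc s) ≡ s C h
compositions≡C zero    zero    = refl
compositions≡C (suc h) zero    = sym (k>n⇒nCk≡0 {0} {suc h} (s≤s z≤n))
compositions≡C zero    (suc s) = compositions≡C zero s
compositions≡C (suc h) (suc s) =
  trans (cong₂ _+_ (compositions≡C h s) (compositions≡C (suc h) s)) (nCk+nC[k+1]≡[n+1]C[k+1] s h)

Positive : List ℕ → Set
Positive = All (1 ≤_)

Comp : ℕ → ℕ → List ℕ → Set
Comp h s xs = length xs ≡ h × Positive xs × sum xs ≡ s

card-Comp : ∀ h s → Card (Comp h s) (compositions h s)
card-Comp zero    zero    = record
  { elems = [] ∷ [] ; unique = [] ∷ [] ; sound = λ { (here refl) → refl , [] , refl }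
  ; complete = λ { {[]} _ → here refl } ; size = refl }
card-Comp zero    (suc s) = card-∅ λ { {[]} (_ , _ , ()) }
card-Comp (suc h) zero    = card-∅ λ { {suc x ∷ xs} (_ , _ , ()) ; {zero ∷ _} (_ , () ∷ _ , _) }
card-Comp (suc h) (suc s) = card-≃ (⇔⇒≃ [ fromOne , fromMore ]′ split)
  (card-∪ (λ { {0 ∷ _} () ; {1 ∷ _} _ () ; {suc (suc _) ∷ _} () })
    (card-≃ one (card-Comp h s)) (card-≃ more (card-Comp (suc h) s)))
  where
  One More : List ℕ → Set
  One (1 ∷ xs) = Comp h s xs
  One _        = ⊥
  More (suc (suc x) ∷ xs) = Comp (suc h) s (suc x ∷ xs)
  More _                  = ⊥
  one : Comp h s ≃ One
  one = record
    { to = 1 ∷_ ; from = drop 1 ; to-∈ = λ c → c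
    ; from-∈ = λ { {1 ∷ _} c → c } ; from-to = λ _ → refl
    ; to-from = λ { {1 ∷ _} _ → refl } }
  sucHead predHead : List ℕ → List ℕ
  sucHead []        = []
  sucHead (x ∷ xs)  = suc x ∷ xs
  predHead []       = []
  predHead (x ∷ xs) = pred x ∷ xs
  more : Comp (suc h) s ≃ More
  more = record
    { to = sucHead ; from = predHead
    ; to-∈ = λ { {suc x ∷ xs} c → c ; {zero ∷ _} (_ , () ∷ _ , _) }
    ; from-∈ = λ { {suc (suc _) ∷ _} c → c }
    ; from-to = λ { {suc x ∷ xs} c → refl ; {zero ∷ _} (_ , () ∷ _ , _) }
    ; to-from = λ { {suc (suc _) ∷ _} c → refl } }
  fromOne : ∀ {xs} → One xs → Comp (suc h) (suc s) xs
  fromOne {1 ∷ xs} (l , p , e) = cong suc l , s≤s z≤n ∷ p , cong suc e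
  fromMore : ∀ {xs} → More xs → Comp (suc h) (suc s) xs
  fromMore {suc (suc x) ∷ xs} (l , _ ∷ p , e) = l , s≤s z≤n ∷ p , cong suc e
  split : ∀ {xs} → Comp (suc h) (suc s) xs → One xs ⊎ More xs
  split {zero ∷ _}        (_ , () ∷ _ , _)
  split {1 ∷ xs}          (l , _ ∷ p , e) = inj₁ (suc-injective l , p , suc-injective e)
  split {suc (suc x) ∷ xs} (l , _ ∷ p , e) = inj₂ (l , s≤s z≤n ∷ p , suc-injective e)

Comp≤ : ℕ → ℕ → List ℕ → Set
Comp≤ h s xs = length xs ≡ h × Positive xs × sum xs ≤ s

-- The slack `suc s ∸ sum xs` is at least 1; prepended as one more part, it makes a composition of
-- `suc s`. All binomials of the formula with a floor on top arise in this way.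
card-Comp≤ : ∀ h s → Card (Comp≤ h s) (s C h)
card-Comp≤ h s = subst (Card (Comp≤ h s)) (compositions≡C h s) (card-≃ slack (card-Comp (suc h) (suc s)))
  where
  slack : Comp (suc h) (suc s) ≃ Comp≤ h s
  slack = record
    { to      = drop 1
    ; from    = λ xs → (suc s ∸ sum xs) ∷ xs
    ; to-∈    = λ { {suc x ∷ xs} (l , _ ∷ p , e) → suc-injective l , p , subst (sum xs ≤_) (suc-injective e) (m≤n+m (sum xs) x)
                  ; {zero ∷ _} (_ , () ∷ _ , _) }
    ; from-∈  = λ { {xs} (l , p , le) → cong suc l , m<n⇒0<n∸m (s≤s le) ∷ p , m∸n+n≡m (≤-trans le (n≤1+n s)) }
    ; from-to = λ { {x ∷ xs} (l , _ , e) → cong (_∷ xs) (trans (cong (_∸ sum xs) (sym e)) (m+n∸n≡m x (sum xs))) }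
    ; to-from = λ _ → refl
    }

-- Sums over a cycle of indices

∑-reverse : ∀ m (f : ℕ → ℕ) → ∑[ k ∈ upTo m ] f (m ∸ k) ≡ ∑[ k ∈ upTo m ] f (suc k)
∑-reverse zero    f = refl
∑-reverse (suc m) f = begin
  ∑[ k ∈ upTo (suc m) ] f (suc m ∸ k)     ≡⟨ ∑-upTo-suc m _ ⟩
  f (suc m) + ∑[ k ∈ upTo m ] f (m ∸ k)   ≡⟨ cong (f (suc m) +_) (∑-reverse m f) ⟩
  f (suc m) + ∑[ k ∈ upTo m ] f (suc k)   ≡⟨ +-comm (f (suc m)) _ ⟩
  ∑[ k ∈ upTo m ] f (suc k) + f (suc m)   ≡⟨ sym (∑-upTo-last m (f ∘ suc)) ⟩
  ∑[ k ∈ upTo (suc m) ] f (suc k)         ∎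
  where open ≡-Reasoning

-- The substitution k ↦ m - k carries 0, ..., m - 1 to 1, ..., m, and `f m ≡ f 0` shifts this range
-- back.
∑-reflect : ∀ m (f g : ℕ → ℕ) → f m ≡ f 0 → (∀ {k} → k ≤ m → g k ≡ f (m ∸ k)) → ∑ (upTo m) g ≡ ∑ (upTo m) f
∑-reflect m f g per eq =
  trans (∑-cong (upTo m) (eq ∘ <⇒≤ ∘ ∈-upTo⁻)) (trans (∑-reverse m f) (∑-shift m f per))

∑≢0⇒witness : ∀ (xs : List A) {f : A → ℕ} → ∑ xs f ≢ 0 → ∃[ x ] f x ≢ 0
∑≢0⇒witness []       ≢0 = ⊥-elim (≢0 refl)
∑≢0⇒witness (x ∷ xs) {f} ≢0 with f x in eq
... | zero  = ∑≢0⇒witness xs ≢0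
... | suc _ = x , λ fx≡0 → 0≢1+n (trans (sym fx≡0) eq)

⟦⟧≢0⇒ : {X : Set} (d : Dec X) → ⟦ d ⟧ ≢ 0 → X
⟦⟧≢0⇒ (yes x) _  = x
⟦⟧≢0⇒ (no _)  ≢0 = ⊥-elim (≢0 refl)

∑-one : (_≟_ : DecidableEquality A) {xs : List A} {a : A} → Unique xs → a ∈ xs → ∑[ x ∈ xs ] ⟦ a ≟ x ⟧ ≡ 1
∑-one _≟_ {xs} {a} u a∈ = trans (∑-cong xs (λ _ → sym (*-identityʳ _)))
  (∑-unique (a ≟_) u a∈ refl (λ _ → sym) (λ _ → 1))

module _ (f : ℕ → ℕ) (period : ∀ k → f (2 + k) ≡ f k) where

  ∑-period2 : ∀ h → ∑ (upTo (h * 2)) f ≡ h * (f 0 + f 1)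
  ∑-period2 zero    = refl
  ∑-period2 (suc h) = begin
    ∑ (upTo (2 + h * 2)) f                                     ≡⟨ ∑-upTo-suc (suc (h * 2)) f ⟩
    f 0 + ∑ (upTo (suc (h * 2))) (f ∘ suc)                     ≡⟨ cong (f 0 +_) (∑-upTo-suc (h * 2) (f ∘ suc)) ⟩
    f 0 + (f 1 + ∑[ k ∈ upTo (h * 2) ] f (2 + k))              ≡⟨ sym (+-assoc (f 0) (f 1) _) ⟩
    f 0 + f 1 + ∑[ k ∈ upTo (h * 2) ] f (2 + k)                ≡⟨ cong (f 0 + f 1 +_) (∑-cong (upTo (h * 2)) λ {k} _ → period k) ⟩
    f 0 + f 1 + ∑ (upTo (h * 2)) f                             ≡⟨ cong (f 0 + f 1 +_) (∑-period2 h) ⟩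
    suc h * (f 0 + f 1)                                        ∎
    where open ≡-Reasoning

  period-even : ∀ h → f (h * 2) ≡ f 0
  period-even zero    = refl
  period-even (suc h) = trans (period (h * 2)) (period-even h)

  period-odd : ∀ h → f (suc (h * 2)) ≡ f 1
  period-odd zero    = refl
  period-odd (suc h) = trans (period (suc (h * 2))) (period-odd h)

  -- The number `suc (h * 2)` is odd, so f 1 = f (suc (h * 2)) = f 0 and f is constant.
  ∑-period2-odd : ∀ h → f (suc (h * 2)) ≡ f 0 → ∑ (upTo (suc (h * 2))) f ≡ suc (h * 2) * f 0
  ∑-period2-odd h eq = begin
    ∑ (upTo (suc (h * 2))) f                  ≡⟨ ∑-upTo-last (h * 2) f ⟩
    ∑ (upTo (h * 2)) f + f (h * 2)            ≡⟨ cong₂ _+_ (∑-period2 h) (period-even h) ⟩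
    h * (f 0 + f 1) + f 0                     ≡⟨ cong (λ t → h * (f 0 + t) + f 0) (trans (sym (period-odd h)) eq) ⟩
    h * (f 0 + f 0) + f 0                     ≡⟨ double h (f 0) ⟩
    suc (h * 2) * f 0                         ∎
    where
    open ≡-Reasoning
    double : ∀ h a → h * (a + a) + a ≡ suc (h * 2) * a
    double = solve-∀

-- Dihedral actions

iter : (A → A) → ℕ → A → A
iter f zero    x = x
iter f (suc k) x = iter f k (f x)

iter-suc : ∀ (f : A → A) k x → iter f k (f x) ≡ f (iter f k x)
iter-suc f zero    x = refl
iter-suc f (suc k) x = iter-suc f k (f x)

iter-+ : ∀ (f : A → A) j k x → iter f (j + k) x ≡ iter f k (iter f j x)
iter-+ f zero    k x = refl
iter-+ f (suc j) k x = iter-+ f j k (f x)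

-- The relations are those of the dihedral group of order 2m. `ρ^m` is asked on `X` only, because m
-- rotations need not fix a list whose length differs from m.
module Burnside
  {A : Set} (_≟_ : DecidableEquality A) (X : A → Set) (m : ℕ) .{{_ : NonZero m}} (ρ τ : A → A)
  (X-ρ : ∀ {x} → X x → X (ρ x)) (X-τ : ∀ {x} → X x → X (τ x))
  (ρ^m : ∀ {x} → X x → iter ρ m x ≡ x)
  (τ² : ∀ x → τ (τ x) ≡ x)
  (ρτρ : ∀ x → ρ (τ (ρ x)) ≡ τ x)
  where

  X-ρ^ : ∀ k {x} → X x → X (iter ρ k x)
  X-ρ^ zero    p = p
  X-ρ^ (suc k) p = X-ρ^ k (X-ρ p)

  ρ^τρ^ : ∀ k x → iter ρ k (τ (iter ρ k x)) ≡ τ x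
  ρ^τρ^ zero    x = refl
  ρ^τρ^ (suc k) x = begin
    iter ρ k (ρ (τ (iter ρ k (ρ x)))) ≡⟨ cong (iter ρ k ∘ ρ ∘ τ) (iter-suc ρ k x) ⟩
    iter ρ k (ρ (τ (ρ (iter ρ k x)))) ≡⟨ cong (iter ρ k) (ρτρ (iter ρ k x)) ⟩
    iter ρ k (τ (iter ρ k x))         ≡⟨ ρ^τρ^ k x ⟩
    τ x                               ∎
    where open ≡-Reasoning

  -- Write x as ρᵏ applied to ρᵐ⁻ᵏ x; then `ρ^τρ^` absorbs the two powers ρᵏ around τ.
  ρ^τ : ∀ {k} → k ≤ m → ∀ {x} → X x → iter ρ k (τ x) ≡ τ (iter ρ (m ∸ k) x)
  ρ^τ {k} k≤m {x} p = begin
    iter ρ k (τ x)                              ≡⟨ cong (iter ρ k ∘ τ) (sym (ρ^m p)) ⟩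
    iter ρ k (τ (iter ρ m x))                   ≡⟨ cong (λ j → iter ρ k (τ (iter ρ j x))) (sym (m∸n+n≡m k≤m)) ⟩
    iter ρ k (τ (iter ρ (m ∸ k + k) x))         ≡⟨ cong (iter ρ k ∘ τ) (iter-+ ρ (m ∸ k) k x) ⟩
    iter ρ k (τ (iter ρ k (iter ρ (m ∸ k) x)))  ≡⟨ ρ^τρ^ k (iter ρ (m ∸ k) x) ⟩
    τ (iter ρ (m ∸ k) x)                        ∎
    where open ≡-Reasoning

  Orbit : A → A → Set
  Orbit x y = ∃[ k ] (y ≡ iter ρ k x ⊎ y ≡ τ (iter ρ k x))

  -- The number of words among the 2m that carry x to y. It depends on x only through its orbit and
  -- vanishes when y lies outside, so it stands in for the orbit-stabilizer theorem: the
  -- decidability and symmetry of `Orbit` and Burnside's count are all read off from it.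
  transporters : A → A → ℕ
  transporters x y = ∑[ k ∈ upTo m ] ⟦ iter ρ k x ≟ y ⟧ + ∑[ k ∈ upTo m ] ⟦ τ (iter ρ k x) ≟ y ⟧

  transporters-ρ : ∀ {x} → X x → ∀ y → transporters (ρ x) y ≡ transporters x y
  transporters-ρ {x} p y = cong₂ _+_
    (∑-shift m (λ k → ⟦ iter ρ k x ≟ y ⟧)     (cong (λ z → ⟦ z ≟ y ⟧) (ρ^m p)))
    (∑-shift m (λ k → ⟦ τ (iter ρ k x) ≟ y ⟧) (cong (λ z → ⟦ τ z ≟ y ⟧) (ρ^m p)))

  transporters-τ : ∀ {x} → X x → ∀ y → transporters (τ x) y ≡ transporters x y
  transporters-τ {x} p y = trans (cong₂ _+_
    (∑-reflect m (λ k → ⟦ τ (iter ρ k x) ≟ y ⟧) _ (cong (λ z → ⟦ τ z ≟ y ⟧) (ρ^m p))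
      λ k≤m → cong (λ z → ⟦ z ≟ y ⟧) (ρ^τ k≤m p))
    (∑-reflect m (λ k → ⟦ iter ρ k x ≟ y ⟧) _ (cong (λ z → ⟦ z ≟ y ⟧) (ρ^m p))
      λ {k} k≤m → cong (λ z → ⟦ z ≟ y ⟧) (trans (cong τ (ρ^τ k≤m p)) (τ² (iter ρ (m ∸ k) x)))))
    (+-comm (∑[ k ∈ upTo m ] ⟦ τ (iter ρ k x) ≟ y ⟧) _)

  transporters-ρ^ : ∀ k {x} → X x → ∀ y → transporters (iter ρ k x) y ≡ transporters x y
  transporters-ρ^ zero    p y = refl
  transporters-ρ^ (suc k) p y = trans (transporters-ρ^ k (X-ρ p) y) (transporters-ρ p y)

  transporters-orbit : ∀ {x y} → X x → Orbit x y → ∀ z → transporters y z ≡ transporters x z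
  transporters-orbit p (k , inj₁ refl) z = transporters-ρ^ k p z
  transporters-orbit p (k , inj₂ refl) z = trans (transporters-τ (X-ρ^ k p) z) (transporters-ρ^ k p z)

  transporters-refl : ∀ x → transporters x x ≢ 0
  transporters-refl x eq = go m (m+n≡0⇒m≡0 _ eq)
    where
    go : ∀ m′ .{{_ : NonZero m′}} → ∑[ k ∈ upTo m′ ] ⟦ iter ρ k x ≟ x ⟧ ≢ 0
    go (suc m′) eq′ with x ≟ x
    ... | no ¬refl = ¬refl refl

  transporters≢0⇒orbit : ∀ {x y} → transporters x y ≢ 0 → Orbit x y
  transporters≢0⇒orbit {x} {y} ≢0 with ∑[ k ∈ upTo m ] ⟦ iter ρ k x ≟ y ⟧ in eq
  ... | suc _ with k , ≢0′ ← ∑≢0⇒witness (upTo m) {λ k → ⟦ iter ρ k x ≟ y ⟧} (λ eq′ → 0≢1+n (trans (sym eq′) eq))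
      = k , inj₁ (sym (⟦⟧≢0⇒ (iter ρ k x ≟ y) ≢0′))
  ... | zero with k , ≢0′ ← ∑≢0⇒witness (upTo m) {λ k → ⟦ τ (iter ρ k x) ≟ y ⟧} ≢0
      = k , inj₂ (sym (⟦⟧≢0⇒ (τ (iter ρ k x) ≟ y) ≢0′))

  -- As many words lead to y from x as from z, and as many from z as from y; from y itself there is
  -- at least the empty word.
  orbit-meet : ∀ {x y z} → X x → X y → Orbit x z → Orbit y z → Orbit x y
  orbit-meet {x} {y} p q o o′ = transporters≢0⇒orbit λ eq → transporters-refl y
    (trans (sym (transporters-orbit q o′ y)) (trans (transporters-orbit p o y) eq))

  orbit-refl : ∀ x → Orbit x x
  orbit-refl x = 0 , inj₁ refl

  orbit-sym : ∀ {x y} → X x → X y → Orbit x y → Orbit y x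
  orbit-sym {y = y} p q o = orbit-meet q p (orbit-refl y) o

  ¬orbit⇒transporters≡0 : ∀ {x y} → ¬ Orbit x y → transporters x y ≡ 0
  ¬orbit⇒transporters≡0 {x} {y} ¬o = cong₂ _+_
    (∑-zero (upTo m) λ {k} _ → ⟦⟧-no (iter ρ k x ≟ y) λ eq → ¬o (k , inj₁ (sym eq)))
    (∑-zero (upTo m) λ {k} _ → ⟦⟧-no (τ (iter ρ k x) ≟ y) λ eq → ¬o (k , inj₂ (sym eq)))

  orbit? : ∀ {x} → X x → ∀ y → Dec (Orbit x y)
  orbit? {x} p y with transporters x y in eq
  ... | zero  = no λ o → transporters-refl y (trans (transporters-orbit p o y) eq)
  ... | suc _ = yes (transporters≢0⇒orbit λ eq′ → 0≢1+n (trans (sym eq′) eq))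

  Transversal : List A → List A → Set
  Transversal xs reps = All X reps × AllPairs (λ x y → ¬ Orbit x y) reps × (∀ {x} → x ∈ xs → Any (Orbit x) reps)

  -- Built from the end of the list: an element joins exactly when it shares its orbit with no
  -- representative chosen so far.
  transversal : ∀ {xs} → All X xs → ∃[ reps ] Transversal xs reps
  transversal []       = [] , [] , [] , λ ()
  transversal {x ∷ xs} (p ∷ ps) with transversal ps
  ... | reps , allX , sep , cov with Any.any? (orbit? p) reps
  ...   | yes a = reps , allX , sep , λ { (here refl) → a ; (there x∈) → cov x∈ }
  ...   | no ¬a = x ∷ reps , p ∷ allX , Allₚ.¬Any⇒All¬ reps ¬a ∷ sep ,
                  λ { (here refl) → here (orbit-refl x) ; (there x∈) → there (cov x∈) }

  -- Only the representative of the orbit of x contributes, and as many words lead from it to x as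
  -- from x to x.
  ∑-transporters-reps : ∀ {x reps} → X x → All X reps → AllPairs (λ y z → ¬ Orbit y z) reps → Any (Orbit x) reps →
                        ∑[ r ∈ reps ] transporters r x ≡ transporters x x
  ∑-transporters-reps {x} {r ∷ reps} p (q ∷ qs) (sep ∷ _) (here o) = trans
    (cong₂ _+_ (transporters-orbit p o x) (∑-zero reps λ {r′} r′∈ → ¬orbit⇒transporters≡0 λ o′ →
      All.lookup sep r′∈ (orbit-meet q (All.lookup qs r′∈) (orbit-sym p q o) o′)))
    (+-identityʳ _)
  ∑-transporters-reps {x} {r ∷ reps} p (q ∷ qs) (sep ∷ seps) (there a) = cong₂ _+_
    (¬orbit⇒transporters≡0 λ o → let ((¬o , q′) , o′) = All.lookupAny (All.zip (sep , qs)) a in ¬o (orbit-meet q q′ o (orbit-sym p q′ o′)))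
    (∑-transporters-reps p qs seps a)

  -- Sum `transporters r x` over all representatives r and all x in two orders. For fixed r each of
  -- the 2m words hits one x, which gives 2m; for fixed x the result is the number of words that fix
  -- x.
  burnside : ∀ {M reps} (c : Card X M) → Transversal (elems c) reps →
             length reps * (m + m) ≡
               ∑[ k ∈ upTo m ] (∑[ x ∈ elems c ] ⟦ iter ρ k x ≟ x ⟧)
               + ∑[ k ∈ upTo m ] (∑[ x ∈ elems c ] ⟦ τ (iter ρ k x) ≟ x ⟧)
  burnside {reps = reps} c (allX , sep , cov) = begin
    length reps * (m + m)
      ≡⟨ sym (∑-const reps (m + m)) ⟩
    ∑[ r ∈ reps ] (m + m)
      ≡⟨ ∑-cong reps (λ r∈ → sym (orbitSum (All.lookup allX r∈))) ⟩
    ∑[ r ∈ reps ] (∑[ x ∈ elems c ] transporters r x)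
      ≡⟨ ∑-swap reps (elems c) transporters ⟩
    ∑[ x ∈ elems c ] (∑[ r ∈ reps ] transporters r x)
      ≡⟨ ∑-cong (elems c) (λ x∈ → ∑-transporters-reps (sound c x∈) allX sep (cov x∈)) ⟩
    ∑[ x ∈ elems c ] transporters x x
      ≡⟨ ∑-+ (elems c) _ _ ⟩
    ∑[ x ∈ elems c ] (∑[ k ∈ upTo m ] ⟦ iter ρ k x ≟ x ⟧) + ∑[ x ∈ elems c ] (∑[ k ∈ upTo m ] ⟦ τ (iter ρ k x) ≟ x ⟧)
      ≡⟨ cong₂ _+_ (∑-swap (elems c) (upTo m) _) (∑-swap (elems c) (upTo m) _) ⟩
    ∑[ k ∈ upTo m ] (∑[ x ∈ elems c ] ⟦ iter ρ k x ≟ x ⟧) + ∑[ k ∈ upTo m ] (∑[ x ∈ elems c ] ⟦ τ (iter ρ k x) ≟ x ⟧)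
      ∎
    where
    open ≡-Reasoning
    ones : (g : ℕ → A) → (∀ k → X (g k)) → ∑[ x ∈ elems c ] (∑[ k ∈ upTo m ] ⟦ g k ≟ x ⟧) ≡ m
    ones g Xg = begin
      ∑[ x ∈ elems c ] (∑[ k ∈ upTo m ] ⟦ g k ≟ x ⟧) ≡⟨ ∑-swap (elems c) (upTo m) _ ⟩
      ∑[ k ∈ upTo m ] (∑[ x ∈ elems c ] ⟦ g k ≟ x ⟧) ≡⟨ ∑-cong (upTo m) (λ {k} _ → ∑-one _≟_ (unique c) (complete c (Xg k))) ⟩
      ∑[ k ∈ upTo m ] 1                              ≡⟨ ∑-const (upTo m) 1 ⟩
      length (upTo m) * 1                            ≡⟨ *-identityʳ _ ⟩
      length (upTo m)                                ≡⟨ length-upTo m ⟩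
      m                                              ∎
    orbitSum : ∀ {r} → X r → ∑[ x ∈ elems c ] transporters r x ≡ m + m
    orbitSum {r} p = trans (∑-+ (elems c) _ _)
      (cong₂ _+_ (ones (λ k → iter ρ k r) (λ k → X-ρ^ k p)) (ones (λ k → τ (iter ρ k r)) (λ k → X-τ (X-ρ^ k p))))

  module _ {M} (c : Card X M) where

    reflectionFixed : ℕ → ℕ
    reflectionFixed k = ∑[ x ∈ elems c ] ⟦ τ (iter ρ k x) ≟ x ⟧

    reflectionFixed-m : reflectionFixed m ≡ reflectionFixed 0
    reflectionFixed-m = ∑-cong (elems c) λ {x} x∈ → cong (λ y → ⟦ τ y ≟ x ⟧) (ρ^m (sound c x∈))

    -- Conjugation by ρ turns τρᵏ⁺² into τρᵏ.
    reflectionFixed-2+ : ∀ k → reflectionFixed (2 + k) ≡ reflectionFixed k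
    reflectionFixed-2+ k = card-unique
      (card-≃ conj (card-filter c (λ x → τ (iter ρ (2 + k) x) ≟ x)))
      (card-filter c (λ x → τ (iter ρ k x) ≟ x))
      where
      ρ⁻¹ : A → A
      ρ⁻¹ = iter ρ (pred m)
      ρ⁻¹ρ : ∀ {x} → X x → ρ⁻¹ (ρ x) ≡ x
      ρ⁻¹ρ {x} p = trans (cong (λ j → iter ρ j x) (suc-pred m)) (ρ^m p)
      ρρ⁻¹ : ∀ {x} → X x → ρ (ρ⁻¹ x) ≡ x
      ρρ⁻¹ {x} p = trans (sym (iter-suc ρ (pred m) x)) (ρ⁻¹ρ p)
      ρτρ^ : ∀ x → ρ (τ (iter ρ (suc k) x)) ≡ τ (iter ρ k x)
      ρτρ^ x = trans (cong (ρ ∘ τ) (iter-suc ρ k x)) (ρτρ (iter ρ k x))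
      conj : (λ x → X x × τ (iter ρ (2 + k) x) ≡ x) ≃ (λ x → X x × τ (iter ρ k x) ≡ x)
      conj = record
        { to      = ρ
        ; from    = ρ⁻¹
        ; to-∈    = λ (p , fix) → X-ρ p , trans (sym (ρτρ^ _)) (cong ρ fix)
        ; from-∈  = λ {y} (q , fix) → X-ρ^ (pred m) q , (begin
            τ (iter ρ (suc k) (ρ (ρ⁻¹ y)))      ≡⟨ cong (τ ∘ iter ρ (suc k)) (ρρ⁻¹ q) ⟩
            τ (iter ρ (suc k) y)                ≡⟨ sym (ρ⁻¹ρ (X-τ (X-ρ^ (suc k) q))) ⟩
            ρ⁻¹ (ρ (τ (iter ρ (suc k) y)))      ≡⟨ cong ρ⁻¹ (trans (ρτρ^ y) fix) ⟩
            ρ⁻¹ y                               ∎)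
        ; from-to = ρ⁻¹ρ ∘ proj₁
        ; to-from = ρρ⁻¹ ∘ proj₁
        }
        where open ≡-Reasoning

-- Rotations, periods and palindromes of lists

ρ : List A → List A
ρ []       = []
ρ (x ∷ xs) = xs ∷ʳ x

iter-ρ-++ : ∀ (us vs : List A) → iter ρ (length us) (us ++ vs) ≡ vs ++ us
iter-ρ-++ []       vs = sym (++-identityʳ vs)
iter-ρ-++ (u ∷ us) vs = begin
  iter ρ (length us) ((us ++ vs) ∷ʳ u) ≡⟨ cong (iter ρ (length us)) (++-assoc us vs [ u ]) ⟩
  iter ρ (length us) (us ++ vs ∷ʳ u)   ≡⟨ iter-ρ-++ us (vs ∷ʳ u) ⟩
  vs ∷ʳ u ++ us                        ≡⟨ ∷ʳ-++ vs u us ⟩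
  vs ++ u ∷ us                         ∎
  where open ≡-Reasoning

iter-ρ-length : ∀ (xs : List A) → iter ρ (length xs) xs ≡ xs
iter-ρ-length xs = trans (cong (iter ρ (length xs)) (sym (++-identityʳ xs))) (iter-ρ-++ xs [])

iter-ρ-period : ∀ {m} {xs : List A} → length xs ≡ m → iter ρ m xs ≡ xs
iter-ρ-period {xs = xs} refl = iter-ρ-length xs

length-take-≤ : ∀ {k} {xs : List A} → k ≤ length xs → length (take k xs) ≡ k
length-take-≤ {k = k} {xs} k≤ = trans (length-take k xs) (m≤n⇒m⊓n≡m k≤)

rotate≡iter-ρ : ∀ {k} xs → k ≤ length xs → rotate k xs ≡ iter ρ k xs
rotate≡iter-ρ {k} xs k≤ = begin
  drop k xs ++ take k xs                                   ≡⟨ sym (iter-ρ-++ (take k xs) (drop k xs)) ⟩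
  iter ρ (length (take k xs)) (take k xs ++ drop k xs)     ≡⟨ cong₂ (iter ρ) (length-take-≤ k≤) (take++drop≡id k xs) ⟩
  iter ρ k xs                                              ∎
  where open ≡-Reasoning

rotate-≥ : ∀ {k} xs → length xs ≤ k → rotate k xs ≡ xs
rotate-≥ {k} xs k≥ = cong₂ _++_ (drop-all k xs k≥) (take-all k xs k≥)

-- Beyond the length `rotate` is the identity while `iter ρ` keeps turning. So the index j grows
-- with k up to the length, a full turn, and then restarts at 1.
iter-ρ⇒rotate : ∀ k xs → ∃[ j ] (j ≤ length xs × iter ρ k xs ≡ rotate j xs)
iter-ρ⇒rotate zero    xs = 0 , z≤n , sym (++-identityʳ xs)
iter-ρ⇒rotate (suc k) xs with iter-ρ⇒rotate k xs
... | j , j≤ , eq with m≤n⇒m<n∨m≡n j≤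
...   | inj₁ j< = suc j , j< , (begin
        iter ρ k (ρ xs)   ≡⟨ iter-suc ρ k xs ⟩
        ρ (iter ρ k xs)   ≡⟨ cong ρ (trans eq (rotate≡iter-ρ xs j≤)) ⟩
        ρ (iter ρ j xs)   ≡⟨ sym (iter-suc ρ j xs) ⟩
        iter ρ (suc j) xs ≡⟨ sym (rotate≡iter-ρ xs j<) ⟩
        rotate (suc j) xs ∎)
  where open ≡-Reasoning
iter-ρ⇒rotate (suc k) []       | j , j≤ , eq | inj₂ j≡ = 0 , z≤n , trans (iter-suc ρ k []) (cong ρ (trans eq (rotate-≥ {j} [] z≤n)))
iter-ρ⇒rotate (suc k) (x ∷ xs) | j , j≤ , eq | inj₂ j≡ = 1 , s≤s z≤n ,
  trans (iter-suc ρ k (x ∷ xs)) (cong ρ (trans eq (rotate-≥ (x ∷ xs) (≤-reflexive (sym j≡)))))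

ρ-reverse-ρ : ∀ (xs : List A) → ρ (reverse (ρ xs)) ≡ reverse xs
ρ-reverse-ρ []       = refl
ρ-reverse-ρ (x ∷ xs) = trans (cong ρ (reverse-++ xs [ x ])) (sym (unfold-reverse x xs))

ρ-↭ : ∀ (xs : List A) → xs ↭ ρ xs
ρ-↭ []       = ↭-refl
ρ-↭ (x ∷ xs) = ∷↭∷ʳ x xs

polygon-↭ : ∀ {m n xs ys} → xs ↭ ys → IsPolygonTuple m n xs → IsPolygonTuple m n ys
polygon-↭ p (l , a , s) = trans (sym (↭-length p)) l , All-resp-↭ p a , trans (sym (sum-↭ p)) s

++-injective : ∀ {us us′ vs vs′ : List A} → length us ≡ length us′ → us ++ vs ≡ us′ ++ vs′ → us ≡ us′ × vs ≡ vs′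
++-injective {us = []}     {[]}      l eq = refl , eq
++-injective {us = u ∷ us} {u′ ∷ us′} l eq =
  let (us≡ , vs≡) = ++-injective {us = us} {us′} (suc-injective l) (∷-injectiveʳ eq)
  in cong₂ _∷_ (∷-injectiveˡ eq) us≡ , vs≡

splitAt-length : ∀ j {k} (xs : List A) → length xs ≡ j + k → ∃[ us ] ∃[ vs ] (xs ≡ us ++ vs × length us ≡ j × length vs ≡ k)
splitAt-length j {k} xs l = take j xs , drop j xs , sym (take++drop≡id j xs) ,
  length-take-≤ (subst (j ≤_) (sym l) (m≤m+n j k)) ,
  trans (length-drop j xs) (trans (cong (_∸ j) l) (m+n∸m≡n j k))

take-++-length : ∀ (us vs : List A) → take (length us) (us ++ vs) ≡ us
take-++-length []       vs = refl
take-++-length (u ∷ us) vs = cong (u ∷_) (take-++-length us vs)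

repeat : ℕ → List A → List A
repeat d us = concat (replicate d us)

length-repeat : ∀ d (us : List A) → length (repeat d us) ≡ d * length us
length-repeat zero    us = refl
length-repeat (suc d) us = trans (length-++ us) (cong (length us +_) (length-repeat d us))

sum-repeat : ∀ d us → sum (repeat d us) ≡ d * sum us
sum-repeat zero    us = refl
sum-repeat (suc d) us = trans (sum-++ us (repeat d us)) (cong (sum us +_) (sum-repeat d us))

All-repeat : ∀ {P : A → Set} d {us} → All P us → All P (repeat d us)
All-repeat zero    p = []
All-repeat (suc d) p = Allₚ.++⁺ p (All-repeat d p)

repeat-comm : ∀ d (us : List A) → repeat d us ++ us ≡ us ++ repeat d us
repeat-comm zero    us = sym (++-identityʳ us)
repeat-comm (suc d) us = trans (++-assoc us (repeat d us) us) (cong (us ++_) (repeat-comm d us))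

-- By length, vs begins with a block as long as us; comparing the two sides shows that the block is
-- us, and the rest of vs again commutes with us.
commute⇒repeat : ∀ d (us vs : List A) → length vs ≡ d * length us → us ++ vs ≡ vs ++ us → vs ≡ repeat d us
commute⇒repeat zero    us []  l eq = refl
commute⇒repeat (suc d) us vs  l eq with splitAt-length (length us) vs l
... | ws , vs′ , refl , l₁ , l₂ with refl , eq′ ← ++-injective {us = us} {ws} (sym l₁) (trans eq (++-assoc ws vs′ us))
    = cong (us ++_) (commute⇒repeat d us vs′ l₂ eq′)

iter-ρ-repeat : ∀ d (us : List A) → iter ρ (length us) (repeat (suc d) us) ≡ repeat (suc d) us
iter-ρ-repeat d us = trans (iter-ρ-++ us (repeat d us)) (repeat-comm d us)

-- Rotation by g exchanges the first block of g entries with the rest, so being fixed means that the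
-- two commute.
iter-ρ-fixed⇒repeat : ∀ d {g} (xs : List A) → length xs ≡ suc d * g → iter ρ g xs ≡ xs → xs ≡ repeat (suc d) (take g xs)
iter-ρ-fixed⇒repeat d {g} xs l fix with splitAt-length g xs l
... | us , vs , refl , refl , l₂ = trans
  (cong (us ++_) (commute⇒repeat d us vs l₂ (trans (sym fix) (iter-ρ-++ us vs))))
  (cong (repeat (suc d)) (sym (take-++-length us vs)))

palindrome-even : ∀ h (xs : List A) → length xs ≡ h + h → reverse xs ≡ xs → xs ≡ take h xs ++ reverse (take h xs)
palindrome-even h xs l pal with splitAt-length h xs l
... | us , vs , refl , refl , l₂ = trans
  (cong (us ++_) (sym (proj₂ (++-injective {us = reverse vs} {us} (trans (length-reverse vs) l₂) (trans (sym (reverse-++ us vs)) pal)))))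
  (cong (λ ws → ws ++ reverse ws) (sym (take-++-length us vs)))

reverse-even : ∀ (us : List A) → reverse (us ++ reverse us) ≡ us ++ reverse us
reverse-even us = trans (reverse-++ us (reverse us)) (cong (_++ reverse us) (reverse-involutive us))

reverse-odd : ∀ (us : List A) c → reverse (us ++ c ∷ reverse us) ≡ us ++ c ∷ reverse us
reverse-odd us c = begin
  reverse (us ++ c ∷ reverse us)            ≡⟨ reverse-++ us (c ∷ reverse us) ⟩
  reverse (c ∷ reverse us) ++ reverse us    ≡⟨ cong (_++ reverse us) (unfold-reverse c (reverse us)) ⟩
  reverse (reverse us) ∷ʳ c ++ reverse us   ≡⟨ cong (λ ws → ws ∷ʳ c ++ reverse us) (reverse-involutive us) ⟩
  us ∷ʳ c ++ reverse us                     ≡⟨ ∷ʳ-++ us c (reverse us) ⟩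
  us ++ c ∷ reverse us                      ∎
  where open ≡-Reasoning

palindrome-odd : ∀ h (xs : List A) → length xs ≡ h + suc h → reverse xs ≡ xs →
                 ∃[ us ] ∃[ c ] (xs ≡ us ++ c ∷ reverse us × length us ≡ h)
palindrome-odd h xs l pal with splitAt-length h xs l
... | us , c ∷ vs , refl , refl , l₂ = us , c , cong (λ ws → us ++ c ∷ ws) vs≡ , refl
  where
  open ≡-Reasoning
  eq : reverse vs ++ c ∷ reverse us ≡ us ++ c ∷ vs
  eq = begin
    reverse vs ++ c ∷ reverse us    ≡⟨ sym (∷ʳ-++ (reverse vs) c (reverse us)) ⟩
    reverse vs ∷ʳ c ++ reverse us   ≡⟨ cong (_++ reverse us) (sym (unfold-reverse c vs)) ⟩
    reverse (c ∷ vs) ++ reverse us  ≡⟨ sym (reverse-++ us (c ∷ vs)) ⟩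
    reverse (us ++ c ∷ vs)          ≡⟨ pal ⟩
    us ++ c ∷ vs                    ∎
  vs≡ : vs ≡ reverse us
  vs≡ = sym (∷-injectiveʳ (proj₂ (++-injective {us = reverse vs} {us} (trans (length-reverse vs) (suc-injective l₂)) eq)))

-- Polygons fixed by a reflection

≤/⇒*≤ : ∀ {s n} d .{{_ : NonZero d}} → s ≤ n / d → s * d ≤ n
≤/⇒*≤ {n = n} d le = ≤-trans (*-monoˡ-≤ d le) (m/n*n≤m n d)

*≤⇒≤/ : ∀ {s n} d .{{_ : NonZero d}} → s * d ≤ n → s ≤ n / d
*≤⇒≤/ {s} {n} d le = subst (_≤ n / d) (m*n/n≡m s d) (/-monoˡ-≤ d le)

-- Reduces a linear inequality to a known one and a ring identity. With `suc` in front of a and x it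
-- yields strict inequalities.
linear : ∀ {a b x y} → a ≤ b → x + b ≡ y + a → x ≤ y
linear {a} {b} {x} {y} a≤b eq = +-cancelʳ-≤ b x y (≤-trans (≤-reflexive eq) (+-monoʳ-≤ y a≤b))

All-≤sum : ∀ us → All (_≤ sum us) us
All-≤sum []       = []
All-≤sum (u ∷ us) = m≤m+n u (sum us) ∷ All.map (λ le → ≤-trans le (m≤n+m (sum us) u)) (All-≤sum us)

positive⇒0<sum : ∀ {k us} → length us ≡ suc k → Positive us → 1 ≤ sum us
positive⇒0<sum {us = u ∷ us} _ (1≤u ∷ _) = ≤-trans 1≤u (m≤m+n u (sum us))

-- Beside each part another positive one remains. The strictness gives 2a < n for parts of a list of
-- sum exactly n/2.
All-<sum : ∀ {k us} → length us ≡ suc (suc k) → Positive us → All (_< sum us) us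
All-<sum {us = u ∷ us} l (1≤u ∷ ps) =
  m<m+n u (positive⇒0<sum (suc-injective l) ps) ∷
  All.map (λ {a} le → +-mono-≤ 1≤u le) (All-≤sum us)

sum-reverse : ∀ us → sum (reverse us) ≡ sum us
sum-reverse us = sum-↭ (↭-reverse us)

All-reverse : ∀ {P : ℕ → Set} {us} → All P us → All P (reverse us)
All-reverse {us = us} = All-resp-↭ (↭-sym (↭-reverse us))

sum-palindrome-odd : ∀ us c → sum (us ++ c ∷ reverse us) ≡ c + sum us * 2
sum-palindrome-odd us c = trans (sum-++ us (c ∷ reverse us))
  (trans (cong (λ t → sum us + (c + t)) (sum-reverse us)) (eq (sum us) c))
  where
  eq : ∀ s c → s + (c + s) ≡ c + s * 2
  eq = solve-∀

length-palindrome-odd : ∀ (us : List ℕ) c → length (us ++ c ∷ reverse us) ≡ suc (length us * 2)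
length-palindrome-odd us c = trans (length-++ us)
  (trans (cong (λ t → length us + suc t) (length-reverse us)) (eq (length us)))
  where
  eq : ∀ s → s + suc s ≡ suc (s * 2)
  eq = solve-∀

sum-palindrome-even : ∀ us → sum (us ++ reverse us) ≡ sum us * 2
sum-palindrome-even us = trans (sum-++ us (reverse us))
  (trans (cong (sum us +_) (sum-reverse us)) (eq (sum us)))
  where
  eq : ∀ s → s + s ≡ s * 2
  eq = solve-∀

length-palindrome-even : ∀ (us : List ℕ) → length (us ++ reverse us) ≡ length us * 2
length-palindrome-even us = trans (length-++ us)
  (trans (cong (length us +_) (length-reverse us)) (eq (length us)))
  where
  eq : ∀ s → s + s ≡ s * 2
  eq = solve-∀

Side : ℕ → ℕ → Set
Side n a = 1 ≤ a × 2 * a < n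

sides : ∀ {n s us} → s * 2 < n → All (_≤ s) us → Positive us → All (Side n) us
sides {s = s} s2<n le ps = All.zipWith
  (λ {a} (1≤a , a≤s) → 1≤a , ≤-<-trans (≤-trans (*-monoʳ-≤ 2 a≤s) (≤-reflexive (*-comm 2 s))) s2<n) (ps , le)

module Odd (h n : ℕ) where

  m : ℕ
  m = suc (h * 2)

  -- With s = `sum us` the side on the axis is c = n - 2s. It is positive when 2s < n and shorter
  -- than n/2 when n < 4s; the other sides are at most s, so 2s < n bounds them too.
  Half Mirror : List ℕ → Set
  Half us = length us ≡ h × Positive us × sum us * 2 < n × n < sum us * 4
  Mirror xs = IsPolygonTuple m n xs × reverse xs ≡ xs

  unfolded : List ℕ → List ℕ
  unfolded us = us ++ (n ∸ sum us * 2) ∷ reverse us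

  middle : ∀ {us c} → sum (us ++ c ∷ reverse us) ≡ n → n ∸ sum us * 2 ≡ c
  middle {us} {c} e = trans (cong (_∸ sum us * 2) (trans (sym e) (sum-palindrome-odd us c))) (m+n∸n≡m c (sum us * 2))

  take-unfolded : ∀ {us c} → length us ≡ h → take h (us ++ c ∷ reverse us) ≡ us
  take-unfolded {us} {c} l = subst (λ k → take k (us ++ c ∷ reverse {A = ℕ} us) ≡ us) l (take-++-length us (c ∷ reverse us))

  unfold-∈ : ∀ {us} → Half us → Mirror (unfolded us)
  unfold-∈ {us} (l , ps , lo , hi) =
    (trans (length-palindrome-odd us c) (cong (λ t → suc (t * 2)) l) ,
     Allₚ.++⁺ all ((m<n⇒0<n∸m lo , 2c<n) ∷ All-reverse all) ,
     trans (sum-palindrome-odd us c) c+)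
    , reverse-odd us c
    where
    c = n ∸ sum us * 2
    c+ : c + sum us * 2 ≡ n
    c+ = m∸n+n≡m (<⇒≤ lo)
    all = sides lo (All-≤sum us) ps
    eq : ∀ c s → suc (2 * c) + s * 4 ≡ c + s * 2 + suc (c + s * 2)
    eq = solve-∀
    2c<n : 2 * c < n
    2c<n = subst (2 * c <_) c+ (linear (subst (_< sum us * 4) (sym c+) hi) (eq c (sum us)))

  fold-∈ : ∀ {us c} → length us ≡ h → Mirror (us ++ c ∷ reverse us) → Half us
  fold-∈ {us} {c} l ((_ , all , e) , _) = l , All.map proj₁ (Allₚ.++⁻ˡ us all) ,
    subst (sum us * 2 <_) e′ (m<n+m (sum us * 2) (proj₁ sideC)) ,
    subst (_< sum us * 4) e′ (linear (subst (2 * c <_) (sym e′) (proj₂ sideC)) (eq c (sum us)))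
    where
    sideC : Side n c
    sideC = All.head (Allₚ.++⁻ʳ us all)
    e′ : c + sum us * 2 ≡ n
    e′ = trans (sym (sum-palindrome-odd us c)) e
    eq : ∀ c s → suc (c + s * 2) + (c + s * 2) ≡ s * 4 + suc (2 * c)
    eq = solve-∀

  mirror : Half ≃ Mirror
  mirror = record
    { to      = unfolded
    ; from    = take h
    ; to-∈    = unfold-∈
    ; from-∈  = λ {xs} p → case xs p λ { us c refl l → subst Half (sym (take-unfolded l)) (fold-∈ l p) }
    ; from-to = λ (l , _) → take-unfolded l
    ; to-from = λ {xs} p → case xs p λ { us c refl l →
        trans (cong unfolded (take-unfolded l)) (cong (λ t → us ++ t ∷ reverse us) (middle {us} (proj₂ (proj₂ (proj₁ p))))) }
    }
    where
    len : ∀ h → suc (h * 2) ≡ h + suc h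
    len = solve-∀
    case : ∀ xs → Mirror xs → {Z : Set} → (∀ us c → xs ≡ us ++ c ∷ reverse us → length us ≡ h → Z) → Z
    case xs ((l , _) , pal) k with us , c , eq , l′ ← palindrome-odd h xs (trans l (len h)) pal = k us c eq l′

  Small : List ℕ → Set
  Small us = length us ≡ h × Positive us × sum us * 2 < n

  -- The lists with 2s < n, that is s ≤ (n - 1)/2, are split by n < 4s or 4s ≤ n. In the second case
  -- 2s < n follows from n ≥ 1, so those are all lists with s ≤ n/4.
  card-Mirror : 1 ≤ n → ∀ {N} → Card Mirror N → N + (n / 4) C h ≡ ((n ∸ 1) / 2) C h
  card-Mirror 1≤n c = card-unique
    (card-≃ (⇔⇒≃ (λ {us} → [ (λ (l , ps , lo , _) → l , ps , lo) , (λ (l , ps , le) → l , ps , quarter {sum us} (≤/⇒*≤ 4 le)) ]′) split)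
      (card-∪ (λ (_ , _ , _ , hi) (_ , _ , le) → <⇒≱ hi (≤/⇒*≤ 4 le))
        (card-≃ (≃-sym mirror) c) (card-Comp≤ h (n / 4))))
    (card-≃ (⇔⇒≃ (λ (l , ps , le) → l , ps , <-≤-trans (s≤s (≤/⇒*≤ 2 le)) (≤-reflexive 1+[n∸1]))
                 (λ (l , ps , lt) → l , ps , *≤⇒≤/ 2 (s≤s⁻¹ (≤-trans lt (≤-reflexive (sym 1+[n∸1]))))))
      (card-Comp≤ h ((n ∸ 1) / 2)))
    where
    1+[n∸1] : suc (n ∸ 1) ≡ n
    1+[n∸1] = m+[n∸m]≡n 1≤n
    quarter : ∀ {s} → s * 4 ≤ n → s * 2 < n
    quarter {zero}  _  = 1≤n
    quarter {suc s} le = <-≤-trans (s≤s (s≤s (s≤s (≤-trans (*-monoʳ-≤ s (s≤s (s≤s z≤n))) (m≤n+m (s * 4) 1))))) le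
    split : ∀ {us} → Small us → Half us ⊎ Comp≤ h (n / 4) us
    split {us} (l , ps , lo) with n <? sum us * 4
    ... | yes hi = inj₁ (l , ps , lo , hi)
    ... | no ¬hi = inj₂ (l , ps , *≤⇒≤/ 4 (≮⇒≥ ¬hi))

-- Oddness is recorded as c + 1 = 2e, because e is the part that replaces an odd first part c in
-- `card-Light`.
evenOrOdd : ∀ c → (∃[ e ] c ≡ e * 2) ⊎ (∃[ e ] suc c ≡ e * 2)
evenOrOdd zero    = inj₁ (0 , refl)
evenOrOdd (suc c) = [ (λ (e , eq) → inj₂ (suc e , cong (suc ∘ suc) eq)) , inj₁ ]′ (evenOrOdd c)

odd≢even : ∀ e e′ → suc (e * 2) ≢ e′ * 2
odd≢even (suc e) (suc e′) eq = odd≢even e e′ (suc-injective (suc-injective eq))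

mapHead : (ℕ → ℕ) → List ℕ → List ℕ
mapHead f []       = []
mapHead f (x ∷ xs) = f x ∷ xs

HeadSatisfies : (ℕ → Set) → List ℕ → Set
HeadSatisfies P []      = ⊥
HeadSatisfies P (x ∷ _) = P x

-- A polygon of perimeter n symmetric in an axis through the two sides x and c, with sides us
-- between them, has x = n − c − 2 sum us; so 2x < n exactly when n < weight (c ∷ us).
weight : List ℕ → ℕ
weight []       = 0
weight (c ∷ us) = c * 2 + sum us * 4

sum*2≤weight : ∀ us → sum us * 2 ≤ weight us
sum*2≤weight []       = z≤n
sum*2≤weight (c ∷ us) = ≤-trans (m≤m+n ((c + sum us) * 2) (sum us * 2)) (≤-reflexive (eq c (sum us)))
  where
  eq : ∀ c s → (c + s) * 2 + s * 2 ≡ c * 2 + s * 4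
  eq = solve-∀

-- An even m ≥ 3 is at least 4, so h ≥ 2 and at least one side, `suc k` in number, lies between the
-- two sides on an axis.
module Even (k n : ℕ) where

  h m : ℕ
  h = suc (suc k)
  m = h * 2

  Light : List ℕ → Set
  Light us = length us ≡ h × Positive us × weight us ≤ n

  -- For c = 2e the condition 2c + 4s ≤ n reads e + s ≤ n/4; for c = 2e - 1 it reads e + s ≤ (n +
  -- 2)/4. In both cases e ranges over the positive integers, so replacing c by e leaves lists of
  -- bounded sum.
  card-Light : Card Light ((n / 4) C h + ((n + 2) / 4) C h)
  card-Light = card-≃ (⇔⇒≃ [ proj₁ , proj₁ ]′ split)
    (card-∪ disjoint (card-≃ even (card-Comp≤ h (n / 4))) (card-≃ odd (card-Comp≤ h ((n + 2) / 4))))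
    where
    EvenHead OddHead : List ℕ → Set
    EvenHead us = Light us × HeadSatisfies (λ c → ∃[ e ] c ≡ e * 2) us
    OddHead  us = Light us × HeadSatisfies (λ c → ∃[ e ] suc c ≡ e * 2) us
    disjoint : ∀ {us} → EvenHead us → OddHead us → ⊥
    disjoint {_ ∷ _} (_ , e , refl) (_ , e′ , eq) = odd≢even e e′ eq
    split : ∀ {us} → Light us → EvenHead us ⊎ OddHead us
    split {c ∷ us} p = [ (λ q → inj₁ (p , q)) , (λ q → inj₂ (p , q)) ]′ (evenOrOdd c)
    eq₁ : ∀ e s → e * 2 * 2 + s * 4 ≡ (e + s) * 4
    eq₁ = solve-∀
    eq₂ : ∀ e s → (e * 2 + 1) * 2 + s * 4 + 2 ≡ (suc e + s) * 4
    eq₂ = solve-∀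
    1≤*2 : ∀ {e} → 1 ≤ e → 1 ≤ e * 2
    1≤*2 {suc e} _ = s≤s z≤n
    1≤e : ∀ {e} → 1 ≤ e * 2 → 1 ≤ e
    1≤e {suc e} _ = s≤s z≤n
    even : Comp≤ h (n / 4) ≃ EvenHead
    even = record
      { to      = mapHead (_* 2)
      ; from    = mapHead (_/ 2)
      ; to-∈    = λ { {e ∷ us} (l , 1≤e ∷ ps , le) →
                    (l , 1≤*2 1≤e ∷ ps , ≤-trans (≤-reflexive (eq₁ e (sum us))) (≤/⇒*≤ 4 le)) , e , refl }
      ; from-∈  = λ { {c ∷ us} ((l , 1≤c ∷ ps , le) , e , refl) →
                    l , subst (1 ≤_) (sym (m*n/n≡m e 2)) (1≤e 1≤c) ∷ ps ,
                    *≤⇒≤/ 4 (≤-trans (≤-reflexive (trans (cong (λ t → (t + sum us) * 4) (m*n/n≡m e 2)) (sym (eq₁ e (sum us))))) le) }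
      ; from-to = λ { {[]} _ → refl ; {e ∷ us} _ → cong (_∷ us) (m*n/n≡m e 2) }
      ; to-from = λ { {c ∷ us} (_ , e , refl) → cong (λ t → t * 2 ∷ us) (m*n/n≡m e 2) }
      }
    odd : Comp≤ h ((n + 2) / 4) ≃ OddHead
    odd = record
      { to      = mapHead (λ e → pred (e * 2))
      ; from    = mapHead (λ c → suc c / 2)
      ; to-∈    = λ { {suc e ∷ us} (l , _ ∷ ps , le) →
                    (l , s≤s z≤n ∷ ps , +-cancelʳ-≤ 2 _ n (≤-trans (≤-reflexive (trans (cong (λ t → t * 2 + sum us * 4 + 2) (+-comm 1 (e * 2))) (eq₂ e (sum us)))) (≤/⇒*≤ 4 le))) , suc e , refl
                    ; {zero ∷ _} (_ , () ∷ _ , _) }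
      ; from-∈  = λ { {suc c ∷ us} ((l , _ ∷ ps , le) , suc e , refl) →
                    l , subst (1 ≤_) (sym (m*n/n≡m (suc e) 2)) (s≤s z≤n) ∷ ps ,
                    *≤⇒≤/ 4 (≤-trans (≤-reflexive (trans (cong (λ t → (t + sum us) * 4) (m*n/n≡m (suc e) 2))
                      (trans (sym (eq₂ e (sum us))) (cong (λ t → t * 2 + sum us * 4 + 2) (+-comm (e * 2) 1))))) (+-monoˡ-≤ 2 le))
                    ; {zero ∷ _} ((_ , () ∷ _ , _) , _) }
      ; from-to = λ { {[]} _ → refl ; {suc e ∷ us} _ → cong (_∷ us) (m*n/n≡m (suc e) 2) ; {zero ∷ _} (_ , () ∷ _ , _) }
      ; to-from = λ { {c ∷ us} (_ , suc e , refl) → cong (λ t → pred (t * 2) ∷ us) (m*n/n≡m (suc e) 2) }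
      }

  -- For x = n - c - 2 `sum us` and the list c ∷ us of total t, 2t = n says x = c and 2t < n says c
  -- < x. In the second case n < `weight` is the bound 2x < n; in the first it is automatic.
  Equal Low : List ℕ → Set
  Equal us = length us ≡ h × Positive us × sum us * 2 ≡ n
  Low us   = length us ≡ h × Positive us × sum us * 2 < n × n < weight us

  lows : ∃[ d ] Card Low d
  lows = _ , card-≃ (⇔⇒≃ (λ ((l , ps , _) , lo , hi) → l , ps , lo , hi)
                          (λ (l , ps , lo , hi) → (l , ps , *≤⇒≤/ 2 (<⇒≤ lo)) , lo , hi))
    (card-filter (card-Comp≤ h (n / 2)) (λ us → (sum us * 2 <? n) ×-dec (n <? weight us)))

  Equal⇒<weight : ∀ {us} → Equal us → n < weight us
  Equal⇒<weight {c ∷ us} (l , _ ∷ ps , e) = subst (_< weight (c ∷ us)) e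
    (<-≤-trans (m<m+n ((c + sum us) * 2) (≤-trans (s≤s z≤n) (*-monoˡ-≤ 2 (positive⇒0<sum (suc-injective l) ps)))) (≤-reflexive (eq c (sum us))))
    where
    eq : ∀ c s → (c + s) * 2 + s * 2 ≡ c * 2 + s * 4
    eq = solve-∀

  -- All lists with 2 `sum us` ≤ n are either light or heavy, and the heavy ones are split by
  -- equality or not. Light lists belong here because `weight` is at least twice the sum.
  card-halves : ∀ {a d} → Card Equal a → Card Low d → a + d + ((n / 4) C h + ((n + 2) / 4) C h) ≡ (n / 2) C h
  card-halves ca cd = card-unique
    (card-≃ (⇔⇒≃ join split)
      (card-∪ (λ { (inj₁ e) (_ , _ , le) → <⇒≱ (Equal⇒<weight e) le ; (inj₂ (_ , _ , _ , hi)) (_ , _ , le) → <⇒≱ hi le })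
        (card-∪ (λ (_ , _ , eq) (_ , _ , lo , _) → <-irrefl eq lo) ca cd)
        card-Light))
    (card-Comp≤ h (n / 2))
    where
    join : ∀ {us} → (Equal us ⊎ Low us) ⊎ Light us → Comp≤ h (n / 2) us
    join (inj₁ (inj₁ (l , ps , eq)))     = l , ps , *≤⇒≤/ 2 (≤-reflexive eq)
    join (inj₁ (inj₂ (l , ps , lo , _))) = l , ps , *≤⇒≤/ 2 (<⇒≤ lo)
    join {us} (inj₂ (l , ps , le))       = l , ps , *≤⇒≤/ 2 (≤-trans (sum*2≤weight us) le)
    split : ∀ {us} → Comp≤ h (n / 2) us → (Equal us ⊎ Low us) ⊎ Light us
    split {us} (l , ps , le) with n <? weight us
    ... | no ¬hi = inj₂ (l , ps , ≮⇒≥ ¬hi)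
    ... | yes hi with m≤n⇒m<n∨m≡n (≤/⇒*≤ {sum us} 2 le)
    ...   | inj₁ lo = inj₁ (inj₂ (l , ps , lo , hi))
    ...   | inj₂ eq = inj₁ (inj₁ (l , ps , eq))

  MirrorVertices MirrorSides : List ℕ → Set
  MirrorVertices xs = IsPolygonTuple m n xs × reverse xs ≡ xs
  MirrorSides xs    = IsPolygonTuple m n xs × reverse (ρ xs) ≡ xs

  mirrorVertices : MirrorVertices ≃ Equal
  mirrorVertices = record
    { to      = take h
    ; from    = λ us → us ++ reverse us
    ; to-∈    = λ {xs} ((l , all , e) , pal) → let eq = palindrome-even h xs (trans l (len h)) pal in
        length-take-≤ {xs = xs} (≤-trans (m≤m+n h h) (≤-reflexive (trans (sym (len h)) (sym l)))) ,
        Allₚ.take⁺ h (All.map proj₁ all) ,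
        trans (sym (sum-palindrome-even (take h xs))) (trans (cong sum (sym eq)) e)
    ; from-∈  = λ {us} (l , ps , e) →
        -- The half has sum exactly n/2, so a bound by the sum must be strict; it is, as the half
        -- has at least two sides.
        let all = All.zipWith (λ {a} (1≤a , a<) → 1≤a , subst (2 * a <_) e (<-≤-trans (*-monoʳ-< 2 a<) (≤-reflexive (*-comm 2 (sum us))))) (ps , All-<sum l ps) in
        (trans (length-palindrome-even us) (cong (_* 2) l) , Allₚ.++⁺ all (All-reverse all) , trans (sum-palindrome-even us) e)
        , reverse-even us
    ; from-to = λ {xs} ((l , _) , pal) → sym (palindrome-even h xs (trans l (len h)) pal)
    ; to-from = λ {us} (l , _) → subst (λ j → take j (us ++ reverse us) ≡ us) l (take-++-length us (reverse us))
    }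
    where
    len : ∀ h → h * 2 ≡ h + h
    len = solve-∀

  Triple : ℕ × ℕ × List ℕ → Set
  Triple (x , c , us) = length us ≡ suc k × Side n x × Side n c × Positive us × x + c + sum us * 2 ≡ n

  -- `reverse ∘ ρ` keeps the first side x and reverses the others. These form a palindrome of odd
  -- length, whose middle c is the second side on the axis.
  mirrorSides : MirrorSides ≃ Triple
  mirrorSides = record
    { to      = fold
    ; from    = unfold
    ; to-∈    = λ {xs} p → case xs p λ { x us c refl l → subst Triple (sym (fold-unfold (l , sumT p))) (triple l p) }
    ; from-∈  = mirror
    ; from-to = λ {xs} p → case xs p λ { x us c refl l → cong unfold (fold-unfold (l , sumT p)) }
    ; to-from = λ (l , _ , _ , _ , e) → fold-unfold (l , e)
    }
    where
    fold : List ℕ → ℕ × ℕ × List ℕ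
    fold []       = 0 , 0 , []
    fold (x ∷ xs) = x , n ∸ (x + sum (take (suc k) xs) * 2) , take (suc k) xs
    unfold : ℕ × ℕ × List ℕ → List ℕ
    unfold (x , c , us) = x ∷ us ++ c ∷ reverse us
    eq : ∀ x c s → x + (c + s * 2) ≡ x + c + s * 2
    eq = solve-∀
    eq′ : ∀ x c s → x + c + s * 2 ≡ c + (x + s * 2)
    eq′ = solve-∀
    sumT : ∀ {x c us} → MirrorSides (unfold (x , c , us)) → x + c + sum us * 2 ≡ n
    sumT {x} {c} {us} ((_ , _ , e) , _) = trans (sym (eq x c (sum us))) (trans (cong (x +_) (sym (sum-palindrome-odd us c))) e)
    fold-unfold : ∀ {x c us} → length us ≡ suc k × x + c + sum us * 2 ≡ n → fold (unfold (x , c , us)) ≡ (x , c , us)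
    fold-unfold {x} {c} {us} (l , e) = begin
      x , n ∸ (x + sum vs * 2) , vs   ≡⟨ cong (λ vs → x , n ∸ (x + sum vs * 2) , vs) vs≡ ⟩
      x , n ∸ (x + sum us * 2) , us   ≡⟨ cong (λ t → x , t ∸ (x + sum us * 2) , us) (trans (sym e) (eq′ x c (sum us))) ⟩
      x , c + (x + sum us * 2) ∸ (x + sum us * 2) , us ≡⟨ cong (λ t → x , t , us) (m+n∸n≡m c (x + sum us * 2)) ⟩
      x , c , us ∎
      where
      open ≡-Reasoning
      vs = take (suc k) (us ++ c ∷ reverse us)
      vs≡ : vs ≡ us
      vs≡ = subst (λ j → take j (us ++ c ∷ reverse us) ≡ us) l (take-++-length us (c ∷ reverse us))
    reverse-ρ : ∀ (x : ℕ) w → reverse (ρ (x ∷ w)) ≡ x ∷ reverse w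
    reverse-ρ x w = reverse-++ w [ x ]
    len : ∀ k → suc (k * 2) ≡ k + suc k
    len = solve-∀
    case : ∀ xs → MirrorSides xs → {Z : Set} → (∀ x us c → xs ≡ unfold (x , c , us) → length us ≡ suc k → Z) → Z
    case (x ∷ w) ((l , _) , pal) f
      with us , c , refl , l′ ← palindrome-odd (suc k) w (trans (suc-injective l) (len (suc k))) (∷-injectiveʳ (trans (sym (reverse-ρ x w)) pal))
      = f x us c refl l′
    triple : ∀ {x c us} → length us ≡ suc k → MirrorSides (unfold (x , c , us)) → Triple (x , c , us)
    triple {us = us} l p@((_ , sx ∷ all , e) , _) = l , sx , All.head (Allₚ.++⁻ʳ us all) , All.map proj₁ (Allₚ.++⁻ˡ us all) , sumT p
    mirror : ∀ {t} → Triple t → MirrorSides (unfold t)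
    mirror {x , c , us} (l , sx , sc , ps , e) =
      (cong suc (trans (length-palindrome-odd us c) (cong (λ t → suc (t * 2)) l)) ,
       sx ∷ Allₚ.++⁺ all (sc ∷ All-reverse all) ,
       trans (cong (x +_) (sum-palindrome-odd us c)) (trans (eq x c (sum us)) e)) ,
      trans (reverse-ρ x (us ++ c ∷ reverse us)) (cong (x ∷_) (reverse-odd us c))
      where
      all = sides (subst (sum us * 2 <_) e (m<n+m (sum us * 2) (≤-trans (proj₁ sx) (m≤m+n x c)))) (All-≤sum us) ps

  Diagonal Above Below : ℕ × ℕ × List ℕ → Set
  Diagonal t@(x , c , _) = Triple t × x ≡ c
  Above    t@(x , c , _) = Triple t × c < x
  Below    t@(x , c , _) = Triple t × x < c

  diagonal : Equal ≃ Diagonal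
  diagonal = record
    { to = to ; from = λ (x , c , us) → c ∷ us
    ; to-∈ = λ { {c ∷ us} (l , 1≤c ∷ ps , e) →
        let side = 1≤c , subst (2 * c <_) e (<-≤-trans (m<m+n (2 * c) (≤-trans (s≤s z≤n) (*-monoˡ-≤ 2 (positive⇒0<sum (suc-injective l) ps)))) (≤-reflexive (eq₁ c (sum us)))) in
        (suc-injective l , side , side , ps , trans (eq₂ c (sum us)) e) , refl }
    ; from-∈ = λ { {x , c , us} ((l , _ , (1≤c , _) , ps , e) , refl) → cong suc l , 1≤c ∷ ps , trans (sym (eq₂ c (sum us))) e }
    ; from-to = λ { {c ∷ us} _ → refl }
    ; to-from = λ { (_ , refl) → refl } }
    where
    to : List ℕ → ℕ × ℕ × List ℕ
    to []       = 0 , 0 , []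
    to (c ∷ us) = c , c , us
    eq₁ : ∀ c s → 2 * c + s * 2 ≡ (c + s) * 2
    eq₁ = solve-∀
    eq₂ : ∀ c s → c + c + s * 2 ≡ (c + s) * 2
    eq₂ = solve-∀

  above : Above ≃ Low
  above = record
    { to = λ (x , c , us) → c ∷ us ; from = from
    ; to-∈ = λ { {x , c , us} ((l , (_ , 2x<n) , (1≤c , _) , ps , e) , c<x) → cong suc l , 1≤c ∷ ps ,
        subst ((c + sum us) * 2 <_) e (linear c<x (eq₁ x c (sum us))) ,
        subst (_< c * 2 + sum us * 4) e (linear (subst (2 * x <_) (sym e) 2x<n) (eq₂ x c (sum us))) }
    ; from-∈ = λ { {c ∷ us} (l , 1≤c ∷ ps , lo , hi) →
        let x = n ∸ (c + sum us * 2)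
            e = rest c us lo
            c<x = linear (subst ((c + sum us) * 2 <_) (sym e) lo) (eq₄ x c (sum us))
        in (suc-injective l ,
            (≤-trans (s≤s z≤n) c<x , subst (2 * x <_) e (linear (subst (_< c * 2 + sum us * 4) (sym e) hi) (eq₅ x c (sum us)))) ,
            (1≤c , ≤-<-trans (≤-trans (m≤m+n (2 * c) (sum us * 2)) (≤-reflexive (eq₃ c (sum us)))) lo) , ps , e) ,
           c<x }
    ; from-to = λ { {x , c , us} ((_ , _ , _ , _ , e) , _) → cong (λ t → t , c , us)
        (trans (cong (_∸ (c + sum us * 2)) (trans (sym e) (+-assoc x c _))) (m+n∸n≡m x (c + sum us * 2))) }
    ; to-from = λ { {c ∷ us} _ → refl } }
    where
    from : List ℕ → ℕ × ℕ × List ℕ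
    from []       = 0 , 0 , []
    from (c ∷ us) = n ∸ (c + sum us * 2) , c , us
    eq₁ : ∀ x c s → suc ((c + s) * 2) + x ≡ x + c + s * 2 + suc c
    eq₁ = solve-∀
    eq₂ : ∀ x c s → suc (x + c + s * 2) + (x + c + s * 2) ≡ c * 2 + s * 4 + suc (2 * x)
    eq₂ = solve-∀
    eq₃ : ∀ c s → 2 * c + s * 2 ≡ (c + s) * 2
    eq₃ = solve-∀
    eq₄ : ∀ x c s → suc c + (x + c + s * 2) ≡ x + suc ((c + s) * 2)
    eq₄ = solve-∀
    eq₅ : ∀ x c s → suc (2 * x) + (c * 2 + s * 4) ≡ x + c + s * 2 + suc (x + c + s * 2)
    eq₅ = solve-∀
    eq₆ : ∀ c s → c + s * 2 + c ≡ (c + s) * 2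
    eq₆ = solve-∀
    rest : ∀ c us → (c + sum us) * 2 < n → n ∸ (c + sum us * 2) + c + sum us * 2 ≡ n
    rest c us lo = trans (+-assoc (n ∸ (c + sum us * 2)) c (sum us * 2))
      (m∸n+n≡m (≤-trans (≤-trans (m≤m+n (c + sum us * 2) c) (≤-reflexive (eq₆ c (sum us)))) (<⇒≤ lo)))

  below : Above ≃ Below
  below = record
    { to = swap ; from = swap ; to-∈ = λ (t , lt) → swapT t , lt ; from-∈ = λ (t , lt) → swapT t , lt
    ; from-to = λ _ → refl ; to-from = λ _ → refl }
    where
    swap : ℕ × ℕ × List ℕ → ℕ × ℕ × List ℕ
    swap (x , c , us) = c , x , us
    swapT : ∀ {t} → Triple t → Triple (swap t)
    swapT {x , c , us} (l , sx , sc , ps , e) = l , sc , sx , ps , trans (cong (_+ sum us * 2) (+-comm c x)) e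

  card-mirrors : ∀ {a b} → Card MirrorVertices a → Card MirrorSides b →
                 ∃[ e ] (a + b ≡ 2 * e × e + ((n / 4) C h + ((n + 2) / 4) C h) ≡ (n / 2) C h)
  card-mirrors {a} {b} ca cb with d , cd ← lows =
    a + d , trans (cong (a +_) b≡) (eq a d) , card-halves ce cd
    where
    ce = card-≃ mirrorVertices ca
    eq : ∀ a d → a + (a + (d + d)) ≡ 2 * (a + d)
    eq = solve-∀
    split : ∀ {t} → Triple t → Diagonal t ⊎ Above t ⊎ Below t
    split {x , c , us} t with <-cmp x c
    ... | tri< lt _ _ = inj₂ (inj₂ (t , lt))
    ... | tri≈ _ eq _ = inj₁ (t , eq)
    ... | tri> _ _ gt = inj₂ (inj₁ (t , gt))
    b≡ : b ≡ a + (d + d)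
    b≡ = card-unique (card-≃ mirrorSides cb)
      (card-≃ (⇔⇒≃ [ proj₁ , [ proj₁ , proj₁ ]′ ]′ split)
        (card-∪ (λ { (_ , refl) (inj₁ (_ , lt)) → <-irrefl refl lt ; (_ , refl) (inj₂ (_ , lt)) → <-irrefl refl lt })
          (card-≃ diagonal ce)
          (card-∪ (λ (_ , gt) (_ , lt) → <-asym gt lt)
            (card-≃ (≃-sym above) cd)
            (card-≃ below (card-≃ (≃-sym above) cd)))))

-- Polygons fixed by a rotation

headSatisfies? : ∀ {P} → Decidable P → Decidable (HeadSatisfies P)
headSatisfies? P? []      = no λ ()
headSatisfies? P? (x ∷ _) = P? x

-- Successive rotations bring each entry of us to the front once; vs collects the entries already
-- passed, which makes the induction go through.
∑-heads : ∀ {P} (P? : Decidable P) us vs →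
          ∑[ k ∈ upTo (length us) ] ⟦ headSatisfies? P? (iter ρ k (us ++ vs)) ⟧ ≡ ∑[ a ∈ us ] ⟦ P? a ⟧
∑-heads P? []       vs = refl
∑-heads P? (u ∷ us) vs = trans (∑-upTo-suc (length us) _) (cong (⟦ P? u ⟧ +_) (begin
  ∑[ k ∈ upTo (length us) ] ⟦ headSatisfies? P? (iter ρ k ((us ++ vs) ∷ʳ u)) ⟧
    ≡⟨ cong (λ ws → ∑[ k ∈ upTo (length us) ] ⟦ headSatisfies? P? (iter ρ k ws) ⟧) (++-assoc us vs [ u ]) ⟩
  ∑[ k ∈ upTo (length us) ] ⟦ headSatisfies? P? (iter ρ k (us ++ vs ∷ʳ u)) ⟧
    ≡⟨ ∑-heads P? us (vs ∷ʳ u) ⟩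
  ∑[ a ∈ us ] ⟦ P? a ⟧ ∎))
  where open ≡-Reasoning

module Oversized (m′ n : ℕ) (3≤m : 3 ≤ suc m′) (1≤n : 1 ≤ n) where

  m : ℕ
  m = suc m′

  Big : ℕ → Set
  Big a = n ≤ 2 * a

  big? : Decidable Big
  big? a = n ≤? 2 * a

  small? : Decidable (All (λ a → 2 * a < n))
  small? = All.all? (λ a → 2 * a <? n)

  Y : Card (Comp m n) (compositions m n)
  Y = card-Comp m n

  comp-ρ : ∀ {xs} → Comp m n xs → Comp m n (ρ xs)
  comp-ρ {xs} (l , ps , e) = trans (sym (↭-length (ρ-↭ xs))) l , All-resp-↭ (ρ-↭ xs) ps , trans (sym (sum-↭ (ρ-↭ xs))) e

  comp-ρ^ : ∀ k {xs} → Comp m n xs → Comp m n (iter ρ k xs)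
  comp-ρ^ zero    p = p
  comp-ρ^ (suc k) p = comp-ρ^ k (comp-ρ p)

  ρ^m : ∀ {xs} → Comp m n xs → iter ρ m xs ≡ xs
  ρ^m (l , _) = iter-ρ-period l

  rotation : Comp m n ≃ Comp m n
  rotation = record
    { to = ρ ; from = iter ρ m′ ; to-∈ = comp-ρ ; from-∈ = comp-ρ^ m′
    ; from-to = ρ^m ; to-from = λ {xs} p → trans (sym (iter-suc ρ m′ xs)) (ρ^m p) }

  ∑-rotated : ∀ k (f : List ℕ → ℕ) → ∑[ y ∈ elems Y ] f (iter ρ k y) ≡ ∑ (elems Y) f
  ∑-rotated zero    f = refl
  ∑-rotated (suc k) f = trans (cong sum (map-∘ {g = f ∘ iter ρ k} {f = ρ} (elems Y)))
    (trans (∑-enum (card-≃ rotation Y) Y (f ∘ iter ρ k)) (∑-rotated k f))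

  -- For x = n - s the inequality n ≤ 2x is 2s ≤ n, so the tail is any list of m - 1 positive parts
  -- with sum at most n/2.
  bigHeads : Card (λ y → Comp m n y × HeadSatisfies Big y) ((n / 2) C m′)
  bigHeads = card-≃ tail (card-Comp≤ m′ (n / 2))
    where
    eq₁ : ∀ x s → x + s + (x + s) ≡ 2 * x + s * 2
    eq₁ = solve-∀
    tail : Comp≤ m′ (n / 2) ≃ (λ y → Comp m n y × HeadSatisfies Big y)
    tail = record
      { to = λ t → (n ∸ sum t) ∷ t ; from = drop 1
      ; to-∈ = λ {t} (l , ps , le) →
          let le′ = ≤/⇒*≤ {sum t} 2 le
              e = m∸n+n≡m (≤-trans (≤-trans (m≤m*n (sum t) 2) le′) ≤-refl)
              x = n ∸ sum t
              bigx : Big x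
              bigx = subst (_≤ 2 * x) e (linear (subst (sum t * 2 ≤_) (sym e) le′) (eq₁ x (sum t)))
          in (cong suc l , positive x bigx ∷ ps , e) , bigx
      ; from-∈ = λ { {x ∷ t} ((l , _ ∷ ps , e) , bigx) → suc-injective l , ps ,
          *≤⇒≤/ 2 (subst (sum t * 2 ≤_) e (linear (subst (_≤ 2 * x) (sym e) bigx) (trans (+-comm _ (2 * x)) (sym (eq₁ x (sum t)))))) }
      ; from-to = λ _ → refl
      ; to-from = λ { {x ∷ t} ((_ , _ , e) , _) → cong (_∷ t) (trans (cong (_∸ sum t) (sym e)) (m+n∸n≡m x (sum t))) } }
      where
      positive : ∀ x → n ≤ 2 * x → 1 ≤ x
      positive zero    n≤0 = ⊥-elim (<⇒≱ 1≤n n≤0)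
      positive (suc x) _   = s≤s z≤n

  -- A side of length at least n/2 leaves at most n/2 to the others, of which there are at least two.
  bigCount : ∀ {y} → Comp m n y → ∑[ a ∈ y ] ⟦ big? a ⟧ + ⟦ small? y ⟧ ≡ 1
  bigCount {y} (l , ps , e) with small? y
  ... | yes small = cong (_+ 1) (∑-zero y λ {b} a∈ → ⟦⟧-no (big? b) (<⇒≱ (All.lookup small a∈)))
  ... | no ¬small with find (Allₚ.¬All⇒Any¬ (λ a → 2 * a <? n) y ¬small)
  ...   | a , a∈ , ¬small-a with us , vs , refl ← ∈-∃++ a∈ = trans (+-identityʳ _) (begin
    ∑ (us ++ a ∷ vs) (λ b → ⟦ big? b ⟧)      ≡⟨ sum-↭ (↭-map⁺ (λ b → ⟦ big? b ⟧) perm) ⟩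
    ⟦ big? a ⟧ + ∑ ws (λ b → ⟦ big? b ⟧)     ≡⟨ cong₂ _+_ (⟦⟧-yes (big? a) big-a) (∑-zero ws λ {b} b∈ → ⟦⟧-no (big? b) (<⇒≱ (2*<n (All.lookup small-ws b∈)))) ⟩
    1                                        ∎)
    where
    open ≡-Reasoning
    ws = us ++ vs
    perm : us ++ a ∷ vs ↭ a ∷ ws
    perm = shift a us vs
    big-a : n ≤ 2 * a
    big-a = ≮⇒≥ ¬small-a
    e′ : a + sum ws ≡ n
    e′ = trans (sym (sum-↭ perm)) e
    len : ∃[ j ] length ws ≡ suc (suc j)
    len = m′ ∸ 2 , trans (suc-injective (trans (sym (↭-length perm)) l)) (sym (m+[n∸m]≡n (s≤s⁻¹ 3≤m)))
    small-ws : All (_< sum ws) ws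
    small-ws = All-<sum (proj₂ len) (All.tail (All-resp-↭ perm ps))
    eq : ∀ a s → 2 * s + 2 * a ≡ a + s + (a + s)
    eq = solve-∀
    2*<n : ∀ {b} → b < sum ws → 2 * b < n
    2*<n b< = <-≤-trans (*-monoʳ-< 2 b<) (subst (2 * sum ws ≤_) e′ (linear (subst (_≤ 2 * a) (sym e′) big-a) (eq a (sum ws))))

  polygons : Card (IsPolygonTuple m n) (∑[ y ∈ elems Y ] ⟦ small? y ⟧)
  polygons = card-≃ (⇔⇒≃ (λ ((l , ps , e) , sm) → l , All.zip (ps , sm) , e)
                         (λ (l , all , e) → (l , All.map proj₁ all , e) , All.map proj₂ all))
    (card-filter Y small?)

  -- By `bigCount` each composition contributes 1. Big parts are sorted by their position k;
  -- rotating k times brings such a part to the front and permutes the compositions, so each of the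
  -- m positions contributes the number in `bigHeads`.
  card-polygons : ∀ {M} → Card (IsPolygonTuple m n) M → m * ((n / 2) C m′) + M ≡ compositions m n
  card-polygons {M} c = sym (begin
    compositions m n
      ≡⟨ sym (trans (∑-const (elems Y) 1) (trans (*-identityʳ _) (size Y))) ⟩
    ∑[ y ∈ elems Y ] 1
      ≡⟨ ∑-cong (elems Y) (λ y∈ → sym (bigCount (sound Y y∈))) ⟩
    ∑[ y ∈ elems Y ] (∑[ a ∈ y ] ⟦ big? a ⟧ + ⟦ small? y ⟧)
      ≡⟨ ∑-+ (elems Y) _ _ ⟩
    ∑[ y ∈ elems Y ] (∑[ a ∈ y ] ⟦ big? a ⟧) + ∑[ y ∈ elems Y ] ⟦ small? y ⟧
      ≡⟨ cong₂ _+_ bigs smalls ⟩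
    m * ((n / 2) C m′) + M ∎)
    where
    open ≡-Reasoning
    smalls : ∑[ y ∈ elems Y ] ⟦ small? y ⟧ ≡ M
    smalls = card-unique polygons c
    heads : ∀ {y} → Comp m n y → ∑[ a ∈ y ] ⟦ big? a ⟧ ≡ ∑[ k ∈ upTo m ] ⟦ headSatisfies? big? (iter ρ k y) ⟧
    heads {y} (l , _) = sym (begin
      ∑[ k ∈ upTo m ] ⟦ headSatisfies? big? (iter ρ k y) ⟧
        ≡⟨ cong₂ (λ j ys → ∑[ k ∈ upTo j ] ⟦ headSatisfies? big? (iter ρ k ys) ⟧) (sym l) (sym (++-identityʳ y)) ⟩
      ∑[ k ∈ upTo (length y) ] ⟦ headSatisfies? big? (iter ρ k (y ++ [])) ⟧
        ≡⟨ ∑-heads big? y [] ⟩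
      ∑[ a ∈ y ] ⟦ big? a ⟧ ∎)
    bigs : ∑[ y ∈ elems Y ] (∑[ a ∈ y ] ⟦ big? a ⟧) ≡ m * ((n / 2) C m′)
    bigs = begin
      ∑[ y ∈ elems Y ] (∑[ a ∈ y ] ⟦ big? a ⟧)
        ≡⟨ ∑-cong (elems Y) (λ y∈ → heads (sound Y y∈)) ⟩
      ∑[ y ∈ elems Y ] (∑[ k ∈ upTo m ] ⟦ headSatisfies? big? (iter ρ k y) ⟧)
        ≡⟨ ∑-swap (elems Y) (upTo m) _ ⟩
      ∑[ k ∈ upTo m ] (∑[ y ∈ elems Y ] ⟦ headSatisfies? big? (iter ρ k y) ⟧)
        ≡⟨ ∑-cong (upTo m) (λ {k} _ → trans (∑-rotated k _) (card-unique (card-filter Y (headSatisfies? big?)) bigHeads)) ⟩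
      ∑[ k ∈ upTo m ] ((n / 2) C m′)
        ≡⟨ trans (∑-const (upTo m) _) (cong (_* ((n / 2) C m′)) (length-upTo m)) ⟩
      m * ((n / 2) C m′) ∎

-- Grouping the rotations by their order

oneTo : ℕ → List ℕ
oneTo m = map suc (upTo m)

∑-oneTo : ∀ m (f : ℕ → ℕ) → ∑ (oneTo m) f ≡ ∑ (upTo m) (f ∘ suc)
∑-oneTo m f = cong sum (sym (map-∘ (upTo m)))

card-oneTo : ∀ m → Card (λ k → 1 ≤ k × k ≤ m) m
card-oneTo m = record
  { elems    = oneTo m
  ; unique   = Uniqueₚ.map⁺ suc-injective (Uniqueₚ.upTo⁺ m)
  ; sound    = λ k∈ → let (j , j∈ , eq) = ∈-map⁻ suc k∈ in subst (λ k → 1 ≤ k × k ≤ m) (sym eq) (s≤s z≤n , ∈-upTo⁻ j∈)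
  ; complete = λ { {suc k} (_ , k<m) → ∈-map⁺ suc (∈-upTo⁺ k<m) }
  ; size     = trans (length-map suc (upTo m)) (length-upTo m)
  }

-- The k with gcd q are the multiples j·q with j ≤ d prime to d.
card-gcd≡ : ∀ q d → 1 ≤ q → ∑[ k ∈ oneTo (q * d) ] ⟦ gcd k (q * d) ≟ q ⟧ ≡ φ d
card-gcd≡ (suc p) d _ = sym (trans (sym (∑-filter (λ k → gcd k d ≟ 1) (oneTo d))) (card-unique
  (card-≃ scale (card-filter (card-oneTo d) (λ k → gcd k d ≟ 1)))
  (card-filter (card-oneTo (q * d)) (λ k → gcd k (q * d) ≟ q))))
  where
  q = suc p
  quotient′ : ∀ {k} → gcd k (q * d) ≡ q → ∃[ j ] (k ≡ j * q)
  quotient′ {k} eq with divides j k≡ ← subst (_∣ k) eq (gcd[m,n]∣m k (q * d)) = j , k≡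
  scale : (λ j → (1 ≤ j × j ≤ d) × gcd j d ≡ 1) ≃ (λ k → (1 ≤ k × k ≤ q * d) × gcd k (q * d) ≡ q)
  scale = record
    { to      = _* q
    ; from    = _/ q
    ; to-∈    = λ { {j} ((1≤j , j≤d) , eq) →
        (*-mono-≤ 1≤j (s≤s (z≤n {p})) , ≤-trans (*-monoˡ-≤ q j≤d) (≤-reflexive (*-comm d q))) ,
        trans (cong (λ t → gcd t (q * d)) (*-comm j q)) (trans (sym (c*gcd[m,n]≡gcd[cm,cn] q j d)) (trans (cong (q *_) eq) (*-identityʳ q))) }
    ; from-∈  = λ ((1≤k , k≤) , eq) → from-∈ (quotient′ eq) 1≤k k≤ eq
    ; from-to = λ {j} _ → m*n/n≡m j q
    ; to-from = λ (_ , eq) → to-from (quotient′ eq)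
    }
    where
    to-from : ∀ {k} → ∃[ j ] (k ≡ j * q) → k / q * q ≡ k
    to-from (j , refl) = cong (_* q) (m*n/n≡m j q)
    from-∈ : ∀ {k} → ∃[ j ] (k ≡ j * q) → 1 ≤ k → k ≤ q * d → gcd k (q * d) ≡ q → (1 ≤ k / q × k / q ≤ d) × gcd (k / q) d ≡ 1
    from-∈ (j , refl) 1≤k k≤ eq = subst (λ i → (1 ≤ i × i ≤ d) × gcd i d ≡ 1) (sym (m*n/n≡m j q))
      ((n≢0⇒n>0 (λ { refl → <⇒≱ 1≤k z≤n }) , *-cancelʳ-≤ j d q (≤-trans k≤ (≤-reflexive (*-comm q d)))) ,
       *-cancelˡ-≡ _ 1 q (trans (c*gcd[m,n]≡gcd[cm,cn] q j d) (trans (cong (λ t → gcd t (q * d)) (*-comm q j)) (trans eq (sym (*-identityʳ q))))))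

-- The value f k depends only on q = gcd k m and the d with m = q·d, which avoids division. Each
-- divisor d determines q and, by `card-gcd≡`, collects φ(d) indices k.
module _ (m : ℕ) (1≤m : 1 ≤ m) (f : ℕ → ℕ) (V : ℕ → ℕ → ℕ)
  (f≡V : ∀ {k} → 1 ≤ k → k ≤ m → ∀ d → m ≡ gcd k m * d → f k ≡ V (gcd k m) d)
  (g : ℕ → ℕ) (g-∣ : ∀ q d → m ≡ q * d → g d ≡ V q d * φ d) (g-∤ : ∀ d → ¬ (d ∣ m) → g d ≡ 0)
  where

  -- The sum is regrouped according to the order d = m / gcd k m of k in ℤ/m.
  ∑-byOrder : ∑ (oneTo m) f ≡ ∑ (oneTo m) g
  ∑-byOrder = begin
    ∑ (oneTo m) f
      ≡⟨ ∑-cong (oneTo m) (λ {k} k∈ → sym (single k (sound (card-oneTo m) k∈))) ⟩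
    ∑[ k ∈ oneTo m ] (∑[ d ∈ oneTo m ] (⟦ m ≟ gcd k m * d ⟧ * f k))
      ≡⟨ ∑-swap (oneTo m) (oneTo m) _ ⟩
    ∑[ d ∈ oneTo m ] (∑[ k ∈ oneTo m ] (⟦ m ≟ gcd k m * d ⟧ * f k))
      ≡⟨ ∑-cong (oneTo m) (λ {d} d∈ → fibre d (proj₁ (sound (card-oneTo m) d∈)) (d ∣? m)) ⟩
    ∑ (oneTo m) g ∎
    where
    open ≡-Reasoning
    factors-positive : ∀ {a b} → m ≡ a * b → 1 ≤ a × 1 ≤ b
    factors-positive {zero} eq = ⊥-elim (<⇒≱ 1≤m (≤-reflexive eq))
    factors-positive {suc a} {zero} eq = ⊥-elim (<⇒≱ 1≤m (≤-reflexive (trans eq (*-zeroʳ a))))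
    factors-positive {suc a} {suc b} eq = s≤s z≤n , s≤s z≤n
    single : ∀ k → 1 ≤ k × k ≤ m → ∑[ d ∈ oneTo m ] (⟦ m ≟ gcd k m * d ⟧ * f k) ≡ f k
    single k _ with divides d eq ← gcd[m,n]∣n k m =
      ∑-unique (λ d → m ≟ gcd k m * d) (unique (card-oneTo m))
        (complete (card-oneTo m) (proj₁ (factors-positive eq) , ≤-trans (m≤m*n d (gcd k m) {{>-nonZero (proj₂ (factors-positive {d} eq))}}) (≤-reflexive (sym eq))))
        (trans eq (*-comm d _))
        (λ {d′} _ eq′ → *-cancelˡ-≡ d′ d (gcd k m) {{>-nonZero (proj₂ (factors-positive {d} eq))}} (trans (sym eq′) (trans eq (*-comm d _))))
        (λ _ → f k)
    fibre : ∀ d → 1 ≤ d → Dec (d ∣ m) → ∑[ k ∈ oneTo m ] (⟦ m ≟ gcd k m * d ⟧ * f k) ≡ g d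
    fibre d _ (no d∤m) = trans
      (∑-zero (oneTo m) λ {k} _ → cong (_* f k) (⟦⟧-no (m ≟ gcd k m * d) (λ eq → d∤m (divides (gcd k m) eq))))
      (sym (g-∤ d d∤m))
    fibre d 1≤d (yes (divides q eq)) = begin
      ∑[ k ∈ oneTo m ] (⟦ m ≟ gcd k m * d ⟧ * f k)
        ≡⟨ ∑-cong (oneTo m) (λ {k} k∈ → pointwise k (sound (card-oneTo m) k∈) (gcd k m ≟ q)) ⟩
      ∑[ k ∈ oneTo m ] (V q d * ⟦ gcd k m ≟ q ⟧)
        ≡⟨ ∑-*ˡ (oneTo m) (V q d) _ ⟩
      V q d * ∑[ k ∈ oneTo m ] ⟦ gcd k m ≟ q ⟧
        ≡⟨ cong (V q d *_) (subst (λ t → ∑[ k ∈ oneTo t ] ⟦ gcd k t ≟ q ⟧ ≡ φ d) (sym eq) (card-gcd≡ q d (proj₁ (factors-positive eq)))) ⟩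
      V q d * φ d
        ≡⟨ sym (g-∣ q d eq) ⟩
      g d ∎
      where
      pointwise : ∀ k → 1 ≤ k × k ≤ m → (dec : Dec (gcd k m ≡ q)) → ⟦ m ≟ gcd k m * d ⟧ * f k ≡ V q d * ⟦ dec ⟧
      pointwise k _ (no gcd≢q) = trans
        (cong (_* f k) (⟦⟧-no (m ≟ gcd k m * d) λ eq′ → gcd≢q (*-cancelʳ-≡ (gcd k m) q d {{>-nonZero 1≤d}} (trans (sym eq′) eq))))
        (sym (*-zeroʳ (V q d)))
      pointwise k (1≤k , k≤m) (yes gcd≡q) = trans
        (cong₂ _*_ (⟦⟧-yes (m ≟ gcd k m * d) eq″) (trans (f≡V 1≤k k≤m d eq″) (cong (λ t → V t d) gcd≡q)))
        (*-comm 1 (V q d))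
        where
        eq″ : m ≡ gcd k m * d
        eq″ = trans eq (cong (_* d) (sym gcd≡q))

words : ℕ → ℕ → ℕ → ℕ
words n g d with d ∣? n
... | yes (divides q _) = compositions g q
... | no _              = 0

words-∣ : ∀ n g d .{{_ : NonZero d}} q → n ≡ q * d → words n g d ≡ compositions g q
words-∣ n g d q eq with d ∣? n
... | yes (divides q′ eq′) = cong (compositions g) (*-cancelʳ-≡ q′ q d (trans (sym eq′) eq))
... | no d∤n               = contradiction (divides q eq) d∤n

words-∤ : ∀ n g d → ¬ (d ∣ n) → words n g d ≡ 0
words-∤ n g d d∤n with d ∣? n
... | yes d∣n = contradiction d∣n d∤n
... | no _    = refl

Word : ℕ → ℕ → ℕ → List ℕ → Set
Word n g d us = length us ≡ g × Positive us × d * sum us ≡ n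

card-Word : ∀ n g d .{{_ : NonZero d}} → Card (Word n g d) (words n g d)
card-Word n g d with d ∣? n
... | yes (divides q eq) = card-≃
  (⇔⇒≃ (λ (l , ps , e) → l , ps , trans (cong (d *_) e) (trans (*-comm d q) (sym eq)))
       (λ (l , ps , e) → l , ps , *-cancelˡ-≡ _ q d (trans e (trans eq (*-comm q d)))))
  (card-Comp g q)
... | no d∤n = card-∅ λ {us} (_ , _ , e) → d∤n (divides (sum us) (trans (sym e) (*-comm d (sum us))))

iter-* : ∀ (f : A → A) j k {x} → iter f k x ≡ x → iter f (j * k) x ≡ x
iter-* f zero    k     fix = refl
iter-* f (suc j) k {x} fix = trans (iter-+ f k (j * k) x) (trans (cong (iter f (j * k)) fix) (iter-* f j k fix))

iter-cancel : ∀ (f : A → A) j k {x} → iter f j x ≡ x → iter f (k + j) x ≡ x → iter f k x ≡ x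
iter-cancel f j k {x} fix fix′ = begin
  iter f k x            ≡⟨ cong (iter f k) (sym fix) ⟩
  iter f k (iter f j x) ≡⟨ sym (iter-+ f j k x) ⟩
  iter f (j + k) x      ≡⟨ cong (λ i → iter f i x) (+-comm j k) ⟩
  iter f (k + j) x      ≡⟨ fix′ ⟩
  x                     ∎
  where open ≡-Reasoning

-- Bézout in ℕ reads gcd + b·k = a·j or gcd + a·j = b·k. Both multiples fix x, and `iter-cancel`
-- removes the smaller one without inverting f.
iter-gcd : ∀ (f : A → A) {x} j k → iter f j x ≡ x → iter f k x ≡ x → iter f (gcd j k) x ≡ x
iter-gcd f {x} j k fj fk with Bézout.identity (gcd-GCD j k)
... | Bézout.Identity.+- a b eq = iter-cancel f (b * k) (gcd j k) (iter-* f b k fk) (trans (cong (λ i → iter f i x) eq) (iter-* f a j fj))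
... | Bézout.Identity.-+ a b eq = iter-cancel f (a * j) (gcd j k) (iter-* f a j fj) (trans (cong (λ i → iter f i x) eq) (iter-* f b k fk))

-- With at least two blocks, and at least three sides, no side reaches half of the perimeter.
repeat-sides : ∀ {n g d us} → 3 ≤ (2 + d) * g → Word n g (2 + d) us → All (Side n) (repeat (2 + d) us)
repeat-sides {g = zero} {d} 3≤ _ = ⊥-elim (<⇒≱ 3≤ (≤-trans (≤-reflexive (*-zeroʳ d)) z≤n))
repeat-sides {n} {suc zero} {zero} (s≤s (s≤s ())) _
repeat-sides {n} {suc (suc g)} {zero} {us} _ (l , ps , e) = All-repeat 2 (All.zipWith
  (λ {a} (1≤a , a<) → 1≤a , <-≤-trans (*-monoʳ-< 2 a<) (≤-reflexive e)) (ps , All-<sum l ps))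
repeat-sides {n} {suc g} {suc d} {us} _ (l , ps , e) = All-repeat (3 + d)
  (sides (subst (sum us * 2 <_) e (<-≤-trans (m<m+n (sum us * 2) (positive⇒0<sum l ps))
    (≤-trans (m≤m+n (sum us * 2 + sum us) (d * sum us)) (≤-reflexive (eq (sum us) (d * sum us)))))) (All-≤sum us) ps)
  where
  eq : ∀ s t → s * 2 + s + t ≡ s + (s + (s + t))
  eq = solve-∀

_≟ᴸ_ : DecidableEquality (List ℕ)
_≟ᴸ_ = ≡-dec _≟_

orderTerm : ℕ → ℕ → ℕ → ℕ
orderTerm m n d with d ∣? m
... | yes (divides q _) = words n q d * φ d
... | no _              = 0

orderTerm-∣ : ∀ m n q d → 1 ≤ m → m ≡ q * d → orderTerm m n d ≡ words n q d * φ d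
orderTerm-∣ m n q zero    1≤m eq = ⊥-elim (<⇒≱ 1≤m (≤-reflexive (trans eq (*-zeroʳ q))))
orderTerm-∣ m n q (suc d) 1≤m eq with suc d ∣? m
... | yes (divides q′ eq′) = cong (λ t → words n t (suc d) * φ (suc d)) (*-cancelʳ-≡ q′ q (suc d) (trans (sym eq′) eq))
... | no d∤m               = contradiction (divides q eq) d∤m

orderTerm-∤ : ∀ m n d → ¬ (d ∣ m) → orderTerm m n d ≡ 0
orderTerm-∤ m n d d∤m with d ∣? m
... | yes d∣m = contradiction d∣m d∤m
... | no _    = refl

module Rotations (m′ n : ℕ) (3≤m : 3 ≤ suc m′) (1≤n : 1 ≤ n) {M} (c : Card (IsPolygonTuple (suc m′) n) M) where

  m : ℕ
  m = suc m′

  rotationFixed : ℕ → ℕ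
  rotationFixed k = ∑[ x ∈ elems c ] ⟦ iter ρ k x ≟ᴸ x ⟧

  iter-m : ∀ {x} → IsPolygonTuple m n x → iter ρ m x ≡ x
  iter-m (l , _) = iter-ρ-period l

  rotationFixed-m : rotationFixed m ≡ M
  rotationFixed-m = begin
    rotationFixed m      ≡⟨ ∑-cong (elems c) (λ {x} x∈ → ⟦⟧-yes (iter ρ m x ≟ᴸ x) (iter-m (sound c x∈))) ⟩
    ∑[ x ∈ elems c ] 1   ≡⟨ ∑-const (elems c) 1 ⟩
    length (elems c) * 1 ≡⟨ trans (*-identityʳ _) (size c) ⟩
    M                    ∎
    where open ≡-Reasoning

  rotationFixed-0 : rotationFixed 0 ≡ rotationFixed m
  rotationFixed-0 = ∑-cong (elems c) λ {x} x∈ → trans (⟦⟧-yes (x ≟ᴸ x) refl) (sym (⟦⟧-yes (iter ρ m x ≟ᴸ x) (iter-m (sound c x∈))))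

  -- A tuple fixed by ρᵏ and ρᵐ is fixed by the power gcd k m, hence repeats its first gcd k m
  -- sides. The form 2 + d of the order excludes the identity, so that by `repeat-sides` every word
  -- repeats to a polygon.
  period : ∀ k d → m ≡ gcd k m * (2 + d) →
           (λ x → IsPolygonTuple m n x × iter ρ k x ≡ x) ≃ Word n (gcd k m) (2 + d)
  period k d eq = record
    { to      = take g
    ; from    = repeat (2 + d)
    ; to-∈    = λ {x} ((l , all , e) , fix) →
        length-take-≤ {xs = x} (≤-trans (≤-trans (m≤m+n g ((1 + d) * g)) (≤-reflexive (sym eq′))) (≤-reflexive (sym l))) ,
        Allₚ.take⁺ g (All.map proj₁ all) ,
        trans (sym (sum-repeat (2 + d) (take g x))) (trans (cong sum (sym (repeated (l , all , e) fix))) e)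
    ; from-∈  = λ {us} w@(l , ps , e) →
        (trans (length-repeat (2 + d) us) (trans (cong ((2 + d) *_) l) (sym eq′)) ,
         repeat-sides {d = d} (subst (3 ≤_) eq′ 3≤m) w ,
         trans (sum-repeat (2 + d) us) e) ,
        fixed us l
    ; from-to = λ (p , fix) → sym (repeated p fix)
    ; to-from = λ {us} (l , _) → subst (λ j → take j (repeat (2 + d) us) ≡ us) l (take-++-length us (repeat (1 + d) us))
    }
    where
    g = gcd k m
    eq′ : m ≡ (2 + d) * g
    eq′ = trans eq (*-comm g (2 + d))
    repeated : ∀ {x} → IsPolygonTuple m n x → iter ρ k x ≡ x → x ≡ repeat (2 + d) (take g x)
    repeated {x} p fix = iter-ρ-fixed⇒repeat (1 + d) {g} x (trans (proj₁ p) eq′) (iter-gcd ρ k m fix (iter-m p))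
    fixed : ∀ us → length us ≡ g → iter ρ k (repeat (2 + d) us) ≡ repeat (2 + d) us
    fixed us l with divides q k≡ ← gcd[m,n]∣m k m = subst (λ j → iter ρ j (repeat (2 + d) us) ≡ repeat (2 + d) us) (sym k≡)
      (iter-* ρ q (gcd k m) (subst (λ j → iter ρ j (repeat (2 + d) us) ≡ repeat (2 + d) us) l (iter-ρ-repeat (1 + d) us)))

  oversized : ℕ
  oversized = m * ((n / 2) C m′)

  -- At k = m, the identity, the added oversized compositions complete the polygons to all
  -- compositions, so one formula covers every k. For k < m the order is not 1, since that would
  -- give m = gcd k m ≤ k.
  rotationFixed≡words : ∀ {k} → 1 ≤ k → k ≤ m → ∀ d → m ≡ gcd k m * d →
                        rotationFixed k + ⟦ m ≟ k ⟧ * oversized ≡ words n (gcd k m) d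
  rotationFixed≡words {k} 1≤k k≤m d eq with m≤n⇒m<n∨m≡n k≤m
  rotationFixed≡words {k} 1≤k k≤m zero eq | inj₁ k<m = ⊥-elim (0≢1+n (sym (trans eq (*-zeroʳ (gcd k m)))))
  rotationFixed≡words {k} 1≤k k≤m (suc zero) eq | inj₁ k<m = ⊥-elim (<⇒≱ k<m
    (≤-trans (≤-reflexive (trans eq (*-identityʳ _))) (∣⇒≤ {{>-nonZero 1≤k}} (gcd[m,n]∣m k m))))
  rotationFixed≡words {k} 1≤k k≤m (suc (suc d)) eq | inj₁ k<m = begin
    rotationFixed k + ⟦ m ≟ k ⟧ * oversized ≡⟨ cong (λ t → rotationFixed k + t * oversized) (⟦⟧-no (m ≟ k) (<⇒≢ k<m ∘ sym)) ⟩
    rotationFixed k + 0                     ≡⟨ +-identityʳ _ ⟩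
    rotationFixed k                         ≡⟨ card-unique (card-≃ (period k d eq) (card-filter c (λ x → iter ρ k x ≟ᴸ x))) (card-Word n (gcd k m) (2 + d)) ⟩
    words n (gcd k m) (2 + d)               ∎
    where open ≡-Reasoning
  rotationFixed≡words 1≤k k≤m d eq | inj₂ refl = begin
    rotationFixed m + ⟦ m ≟ m ⟧ * oversized ≡⟨ cong₂ (λ a b → a + b * oversized) rotationFixed-m (⟦⟧-yes (m ≟ m) refl) ⟩
    M + 1 * oversized                       ≡⟨ cong (M +_) (*-identityˡ oversized) ⟩
    M + oversized                           ≡⟨ +-comm M oversized ⟩
    oversized + M                           ≡⟨ Oversized.card-polygons m′ n 3≤m 1≤n c ⟩
    compositions m n                        ≡⟨ sym (words-∣ n m 1 n (sym (*-identityʳ n))) ⟩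
    words n m 1                             ≡⟨ cong₂ (words n) (sym gcd≡) (sym d≡1) ⟩
    words n (gcd m m) d                     ∎
    where
    open ≡-Reasoning
    gcd≡ : gcd m m ≡ m
    gcd≡ = ≤-antisym (∣⇒≤ (gcd[m,n]∣m m m)) (∣⇒≤ {{>-nonZero (n≢0⇒n>0 λ g≡0 → 0≢1+n (sym (trans eq (cong (_* d) g≡0))))}} (gcd-greatest (divides 1 (sym (*-identityˡ m))) (divides 1 (sym (*-identityˡ m)))))
    d≡1 : d ≡ 1
    d≡1 = *-cancelˡ-≡ d 1 m (trans (cong (_* d) (sym gcd≡)) (trans (sym eq) (sym (*-identityʳ m))))

  ∑-rotationFixed : ∑ (upTo m) rotationFixed + oversized ≡ ∑ (oneTo m) (orderTerm m n)
  ∑-rotationFixed = begin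
    ∑ (upTo m) rotationFixed + oversized
      -- The identity moves from k = 0 to k = m, to match the range 1, ..., m in the definition of
      -- φ.
      ≡⟨ cong (_+ oversized) (sym (∑-shift m rotationFixed (sym rotationFixed-0))) ⟩
    ∑ (upTo m) (rotationFixed ∘ suc) + oversized
      ≡⟨ cong₂ _+_ (sym (∑-oneTo m rotationFixed)) (sym single) ⟩
    ∑ (oneTo m) rotationFixed + ∑[ k ∈ oneTo m ] (⟦ m ≟ k ⟧ * oversized)
      ≡⟨ sym (∑-+ (oneTo m) rotationFixed _) ⟩
    ∑[ k ∈ oneTo m ] (rotationFixed k + ⟦ m ≟ k ⟧ * oversized)
      ≡⟨ ∑-byOrder m (s≤s z≤n) _ (words n) rotationFixed≡words (orderTerm m n) (λ q d → orderTerm-∣ m n q d (s≤s z≤n)) (orderTerm-∤ m n) ⟩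
    ∑ (oneTo m) (orderTerm m n) ∎
    where
    open ≡-Reasoning
    single : ∑[ k ∈ oneTo m ] (⟦ m ≟ k ⟧ * oversized) ≡ oversized
    single = ∑-unique (m ≟_) (unique (card-oneTo m)) (complete (card-oneTo m) (s≤s z≤n , ≤-refl)) refl (λ _ → sym) (λ _ → oversized)

-- From orders to the divisor sum

divisorTerm : ∀ m n → Σ[ f ∈ (ℕ → ℕ) ] divisorSum m n ≡ foldr (λ k acc → f k + acc) 0 (upTo (gcd m n))
-- The summand is local to `divisorSum`; unfolding the sum solves the underscore and so gives it a
-- name.
divisorTerm m n = _ , refl

divisorTerm-∣ : ∀ {m n} k → suc k ∣ gcd m n → proj₁ (divisorTerm m n) k ≡ φ (suc k) * ((n / suc k) C (m / suc k))
divisorTerm-∣ {m} {n} k d∣g with suc k ∣? gcd m n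
... | yes _  = refl
... | no d∤g = contradiction d∣g d∤g

divisorTerm-∤ : ∀ {m n} k → ¬ (suc k ∣ gcd m n) → proj₁ (divisorTerm m n) k ≡ 0
divisorTerm-∤ {m} {n} k d∤g with suc k ∣? gcd m n
... | yes d∣g = contradiction d∣g d∤g
... | no _    = refl

∑-foldr : ∀ (xs : List ℕ) (f : ℕ → ℕ) → foldr (λ k acc → f k + acc) 0 xs ≡ ∑ xs f
∑-foldr []       f = refl
∑-foldr (x ∷ xs) f = cong (f x +_) (∑-foldr xs f)

∑-truncate : ∀ g j (f : ℕ → ℕ) → (∀ k → g ≤ k → f k ≡ 0) → ∑ (upTo (j + g)) f ≡ ∑ (upTo g) f
∑-truncate g zero    f eq = refl
∑-truncate g (suc j) f eq = trans (∑-upTo-last (j + g) f)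
  (trans (cong₂ _+_ (∑-truncate g j f eq) (eq (j + g) (m≤n+m g j))) (+-identityʳ _))

-- With n = (p + 1)d and m = (q + 1)d this is `absorption p q` multiplied by d φ(d). If d fails to
-- divide m or n, both sides vanish.
orderTerm-divisorTerm : ∀ {m n} k → 1 ≤ m → 1 ≤ n → n * orderTerm m n (suc k) ≡ m * proj₁ (divisorTerm m n) k
orderTerm-divisorTerm {m} {n} k 1≤m 1≤n = go (suc k ∣? m) (suc k ∣? n)
  where
  open ≡-Reasoning
  d = suc k
  eq₁ : ∀ p d c f → p * d * (c * f) ≡ p * c * (d * f)
  eq₁ = solve-∀
  eq₂ : ∀ q d c f → q * c * (d * f) ≡ q * d * (f * c)
  eq₂ = solve-∀
  go : Dec (suc k ∣ m) → Dec (suc k ∣ n) → n * orderTerm m n (suc k) ≡ m * proj₁ (divisorTerm m n) k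
  go (no d∤m) _ = trans (cong (n *_) (orderTerm-∤ m n (suc k) d∤m)) (trans (*-zeroʳ n)
      (sym (trans (cong (m *_) (divisorTerm-∤ {m} {n} k λ d∣g → d∤m (∣-trans d∣g (gcd[m,n]∣m m n)))) (*-zeroʳ m))))
  go (yes (divides q m≡)) (no d∤n) = trans (cong (n *_) (trans (orderTerm-∣ m n q (suc k) 1≤m m≡) (cong (_* φ (suc k)) (words-∤ n q (suc k) d∤n)))) (trans (*-zeroʳ n)
      (sym (trans (cong (m *_) (divisorTerm-∤ {m} {n} k λ d∣g → d∤n (∣-trans d∣g (gcd[m,n]∣n m n)))) (*-zeroʳ m))))
  go (yes (divides zero m≡)) (yes _) = ⊥-elim (<⇒≱ 1≤m (≤-reflexive m≡))
  go (yes _) (yes (divides zero n≡)) = ⊥-elim (<⇒≱ 1≤n (≤-reflexive n≡))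
  go (yes d∣m@(divides (suc q) m≡)) (yes d∣n@(divides (suc p) n≡)) = begin
    n * orderTerm m n d                              ≡⟨ cong (n *_) (orderTerm-∣ m n (suc q) d 1≤m m≡) ⟩
    n * (words n (suc q) d * φ d)                    ≡⟨ cong (λ t → n * (t * φ d)) (trans (words-∣ n (suc q) d (suc p) n≡) (compositions≡C q p)) ⟩
    n * ((p C q) * φ d)                              ≡⟨ cong (_* ((p C q) * φ d)) n≡ ⟩
    suc p * d * ((p C q) * φ d)                      ≡⟨ eq₁ (suc p) d (p C q) (φ d) ⟩
    suc p * (p C q) * (d * φ d)                      ≡⟨ cong (_* (d * φ d)) (sym (absorption p q)) ⟩
    suc q * (suc p C suc q) * (d * φ d)              ≡⟨ eq₂ (suc q) d (suc p C suc q) (φ d) ⟩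
    suc q * d * (φ d * (suc p C suc q))              ≡⟨ cong (_* (φ d * (suc p C suc q))) (sym m≡) ⟩
    m * (φ d * (suc p C suc q))                      ≡⟨ cong (λ t → m * (φ d * t)) (cong₂ _C_ (sym (n/m≡quotient d∣n)) (sym (n/m≡quotient d∣m))) ⟩
    m * (φ d * ((n / d) C (m / d)))                  ≡⟨ cong (m *_) (sym (divisorTerm-∣ {m} {n} k (gcd-greatest d∣m d∣n))) ⟩
    m * proj₁ (divisorTerm m n) k                    ∎

∑-orderTerm : ∀ {m n} → 1 ≤ m → 1 ≤ n → n * ∑ (oneTo m) (orderTerm m n) ≡ m * divisorSum m n
∑-orderTerm {m} {n} 1≤m 1≤n = begin
  n * ∑ (oneTo m) (orderTerm m n)                         ≡⟨ cong (n *_) (∑-oneTo m _) ⟩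
  n * ∑[ k ∈ upTo m ] orderTerm m n (suc k)               ≡⟨ sym (∑-*ˡ (upTo m) n _) ⟩
  ∑[ k ∈ upTo m ] (n * orderTerm m n (suc k))             ≡⟨ ∑-cong (upTo m) (λ {k} _ → orderTerm-divisorTerm k 1≤m 1≤n) ⟩
  ∑[ k ∈ upTo m ] (m * term k)                            ≡⟨ ∑-*ˡ (upTo m) m _ ⟩
  m * ∑ (upTo m) term                                     ≡⟨ cong (λ t → m * ∑ (upTo t) term) (sym (m∸n+n≡m g≤m)) ⟩
  m * ∑ (upTo (m ∸ gcd m n + gcd m n)) term               ≡⟨ cong (m *_) (∑-truncate (gcd m n) (m ∸ gcd m n) term beyond) ⟩
  m * ∑ (upTo (gcd m n)) term                             ≡⟨ cong (m *_) (sym (trans (proj₂ (divisorTerm m n)) (∑-foldr (upTo (gcd m n)) term))) ⟩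
  m * divisorSum m n                                      ∎
  where
  open ≡-Reasoning
  term = proj₁ (divisorTerm m n)
  g≤m : gcd m n ≤ m
  g≤m = ∣⇒≤ {{>-nonZero 1≤m}} (gcd[m,n]∣m m n)
  beyond : ∀ k → gcd m n ≤ k → term k ≡ 0
  beyond k g≤k = divisorTerm-∤ {m} {n} k λ d∣g → <⇒≱ (s≤s g≤k) (∣⇒≤ {{>-nonZero 1≤g}} d∣g)
    where
    1≤g : 1 ≤ gcd m n
    1≤g = n≢0⇒n>0 λ g≡0 → <⇒≱ 1≤m (≤-reflexive (gcd[m,n]≡0⇒m≡0 g≡0))

-- Counting the orbits

polygon-ρ : ∀ {m n xs} → IsPolygonTuple m n xs → IsPolygonTuple m n (ρ xs)
polygon-ρ {xs = xs} = polygon-↭ (ρ-↭ xs)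

polygon-reverse : ∀ {m n xs} → IsPolygonTuple m n xs → IsPolygonTuple m n (reverse xs)
polygon-reverse {xs = xs} = polygon-↭ (↭-sym (↭-reverse xs))

module Polygons (m n : ℕ) .{{_ : NonZero m}} = Burnside _≟ᴸ_ (IsPolygonTuple m n) m ρ reverse
  polygon-ρ polygon-reverse (λ p → iter-ρ-period (proj₁ p)) reverse-involutive ρ-reverse-ρ

module _ (m n : ℕ) .{{_ : NonZero m}} where
  open Polygons m n

  equiv⇒orbit : ∀ {xs ys} → Equiv xs ys → Orbit xs ys
  equiv⇒orbit {xs} {ys} (k , e) with ≤-total k (length xs)
  ... | inj₁ k≤ = k , subst (λ zs → ys ≡ zs ⊎ ys ≡ reverse zs) (rotate≡iter-ρ xs k≤) e
  ... | inj₂ k≥ = 0 , subst (λ zs → ys ≡ zs ⊎ ys ≡ reverse zs) (rotate-≥ xs k≥) e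

  orbit⇒equiv : ∀ {xs ys} → Orbit xs ys → Equiv xs ys
  orbit⇒equiv {xs} {ys} (k , e) with j , _ , eq ← iter-ρ⇒rotate k xs = j , subst (λ zs → ys ≡ zs ⊎ ys ≡ reverse zs) eq e

module _ (m n : ℕ) .{{_ : NonZero m}} {M} (c : Card (IsPolygonTuple m n) M) where

  reflections : ℕ
  reflections = ∑ (upTo m) (Polygons.reflectionFixed m n c)

  -- Here e is the mean number of polygons fixed by a reflection.
  ReflectionFormula : Set
  ReflectionFormula = ∃[ e ] (reflections ≡ m * e ×
    e + ((n / 4) C (m / 2) + binomHalf ((n + 2) / 4) m) ≡ (m / 2 + (n ∸ m) / 2) C (m / 2))

binomHalf-even : ∀ x h → binomHalf x (h * 2) ≡ x C h
binomHalf-even x h rewrite m*n%n≡0 h 2 {{_}} | m*n/n≡m h 2 {{_}} = refl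

binomHalf-odd : ∀ x h → binomHalf x (suc (h * 2)) ≡ 0
binomHalf-odd x h rewrite [m+kn]%n≡m%n 1 h 2 {{_}} = refl

-- Of the 2h reflections, h fix as many polygons as τ and h as many as τρ. These two numbers add up
-- to 2e, which makes the mean an integer.
reflections-even : ∀ k n → suc (suc k) * 2 ≤ n → ∀ {M} (c : Card (IsPolygonTuple (suc (suc k) * 2) n) M) →
                   ReflectionFormula (suc (suc k) * 2) n c
reflections-even k n m≤n c = e
  , (begin
      ∑ (upTo (h * 2)) F  ≡⟨ ∑-period2 F (Polygons.reflectionFixed-2+ (h * 2) n c) h ⟩
      h * (F 0 + F 1)     ≡⟨ cong (h *_) (proj₁ (proj₂ mirrors)) ⟩
      h * (2 * e)         ≡⟨ sym (*-assoc h 2 e) ⟩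
      h * 2 * e           ∎)
  , (begin
      e + ((n / 4) C (h * 2 / 2) + binomHalf ((n + 2) / 4) (h * 2))
        ≡⟨ cong (e +_) (cong₂ _+_ (cong ((n / 4) C_) h≡) (binomHalf-even ((n + 2) / 4) h)) ⟩
      e + ((n / 4) C h + ((n + 2) / 4) C h)         ≡⟨ proj₂ (proj₂ mirrors) ⟩
      (n / 2) C h                                   ≡⟨ cong₂ _C_ (sym top) (sym h≡) ⟩
      (h * 2 / 2 + (n ∸ h * 2) / 2) C (h * 2 / 2)   ∎)
  where
  open ≡-Reasoning
  h = suc (suc k)
  mirrors : ∃[ e ] (Polygons.reflectionFixed (h * 2) n c 0 + Polygons.reflectionFixed (h * 2) n c 1 ≡ 2 * e ×
                    e + ((n / 4) C h + ((n + 2) / 4) C h) ≡ (n / 2) C h)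
  mirrors = Even.card-mirrors k n (card-filter c (λ x → reverse x ≟ᴸ x)) (card-filter c (λ x → reverse (ρ x) ≟ᴸ x))
  e = proj₁ mirrors
  F = Polygons.reflectionFixed (h * 2) n c
  h≡ : h * 2 / 2 ≡ h
  h≡ = m*n/n≡m h 2
  top : h * 2 / 2 + (n ∸ h * 2) / 2 ≡ n / 2
  top = trans (cong₂ _+_ h≡ ([m∸n*o]/o≡m/o∸n n h 2)) (m+[n∸m]≡n (*≤⇒≤/ {h} 2 m≤n))

-- All reflections fix as many polygons as τ. The upper index m/2 + (n - m)/2 is the floor of (n -
-- 1)/2 here, and of n/2 for even m.
reflections-odd : ∀ h n → suc (h * 2) ≤ n → ∀ {M} (c : Card (IsPolygonTuple (suc (h * 2)) n) M) →
                  ReflectionFormula (suc (h * 2)) n c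
reflections-odd h n m≤n c = F 0
  , ∑-period2-odd F (Polygons.reflectionFixed-2+ m n c) h (Polygons.reflectionFixed-m m n c)
  , (begin
      F 0 + ((n / 4) C (m / 2) + binomHalf ((n + 2) / 4) m)
        ≡⟨ cong (F 0 +_) (cong₂ _+_ (cong ((n / 4) C_) h≡) (binomHalf-odd ((n + 2) / 4) h)) ⟩
      F 0 + ((n / 4) C h + 0)            ≡⟨ cong (F 0 +_) (+-identityʳ _) ⟩
      F 0 + (n / 4) C h                  ≡⟨ Odd.card-Mirror h n (≤-trans (s≤s z≤n) m≤n) (card-filter c (λ x → reverse x ≟ᴸ x)) ⟩
      ((n ∸ 1) / 2) C h                  ≡⟨ cong₂ _C_ (sym top) (sym h≡) ⟩
      (m / 2 + (n ∸ m) / 2) C (m / 2)    ∎)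
  where
  open ≡-Reasoning
  m = suc (h * 2)
  F = Polygons.reflectionFixed m n c
  h≡ : m / 2 ≡ h
  h≡ = trans (+-distrib-/-∣ʳ 1 {h * 2} {2} (divides h refl)) (m*n/n≡m h 2)
  top : m / 2 + (n ∸ m) / 2 ≡ (n ∸ 1) / 2
  top = trans (cong₂ _+_ h≡ (trans (cong (_/ 2) (sym (∸-+-assoc n 1 (h * 2)))) ([m∸n*o]/o≡m/o∸n (n ∸ 1) h 2)))
    (m+[n∸m]≡n (*≤⇒≤/ {h} 2 (∸-monoˡ-≤ 1 m≤n)))

reflectionFormula : ∀ m n .{{_ : NonZero m}} → 3 ≤ m → m ≤ n → ∀ {M} (c : Card (IsPolygonTuple m n) M) → ReflectionFormula m n c
reflectionFormula m n 3≤m m≤n c with evenOrOdd m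
... | inj₁ (suc (suc k) , refl) = reflections-even k n m≤n c
... | inj₁ (suc zero , refl)    = ⊥-elim (<⇒≱ 3≤m ≤-refl)
... | inj₁ (zero , refl)        = ⊥-elim (<⇒≱ 3≤m z≤n)
... | inj₂ (suc h , eq) with refl ← suc-injective eq = reflections-odd h n m≤n c

-- Assembling the formula

combine-counts : ∀ m n r s t d e c₀ c₁ c₂ c₃ .{{_ : NonZero m}} →
          r * (m + m) ≡ s + m * e → s + m * c₁ ≡ t → n * t ≡ m * d → e + (c₂ + c₃) ≡ c₀ →
          r * (2 * n) + n * (c₁ + c₂ + c₃) ≡ d + n * c₀
-- Multiplying by m makes Burnside's factor 2m appear, and the divisor sum enters through n·t = m·d;
-- then m cancels.
combine-counts m n r s t d e c₀ c₁ c₂ c₃ burnside rotations orders mirrors = *-cancelˡ-≡ _ _ m (begin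
  m * (r * (2 * n) + n * (c₁ + c₂ + c₃))            ≡⟨ eq₁ m n r c₁ c₂ c₃ ⟩
  n * (r * (m + m)) + n * m * (c₁ + c₂ + c₃)        ≡⟨ cong (λ x → n * x + n * m * (c₁ + c₂ + c₃)) burnside ⟩
  n * (s + m * e) + n * m * (c₁ + c₂ + c₃)          ≡⟨ eq₂ m n s e c₁ c₂ c₃ ⟩
  n * (s + m * c₁) + m * (n * (e + (c₂ + c₃)))      ≡⟨ cong₂ (λ x y → n * x + m * (n * y)) rotations mirrors ⟩
  n * t + m * (n * c₀)                              ≡⟨ cong (_+ m * (n * c₀)) orders ⟩
  m * d + m * (n * c₀)                              ≡⟨ sym (*-distribˡ-+ m d (n * c₀)) ⟩
  m * (d + n * c₀)                                  ∎)
  where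
  open ≡-Reasoning
  eq₁ : ∀ m n r c₁ c₂ c₃ → m * (r * (2 * n) + n * (c₁ + c₂ + c₃)) ≡ n * (r * (m + m)) + n * m * (c₁ + c₂ + c₃)
  eq₁ = solve-∀
  eq₂ : ∀ m n s e c₁ c₂ c₃ → n * (s + m * e) + n * m * (c₁ + c₂ + c₃) ≡ n * (s + m * c₁) + m * (n * (e + (c₂ + c₃)))
  eq₂ = solve-∀

module _ (r d n′ c₀ c₁ c₂ c₃ : ℕ) 
  (count : r * (2 * suc n′) + suc n′ * (c₁ + c₂ + c₃) ≡ d + suc n′ * c₀) where

  private
    n : ℕ
    n = suc n′

    num : ℤ
    num = pos c₀ ℤ.- pos c₁ ℤ.- pos c₂ ℤ.- pos c₃

    countℤ : pos r ℤ.* (pos 2 ℤ.* pos n) ℤ.+ pos n ℤ.* (pos c₁ ℤ.+ pos c₂ ℤ.+ pos c₃) ≡ pos d ℤ.+ pos n ℤ.* pos c₀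
    countℤ = begin
      pos r ℤ.* (pos 2 ℤ.* pos n) ℤ.+ pos n ℤ.* (pos (c₁ + c₂ + c₃))
        ≡⟨ cong₂ ℤ._+_ (trans (cong (pos r ℤ.*_) (sym (ℤₚ.pos-* 2 n))) (sym (ℤₚ.pos-* r (2 * n)))) (sym (ℤₚ.pos-* n (c₁ + c₂ + c₃))) ⟩
      pos (r * (2 * n) + n * (c₁ + c₂ + c₃)) ≡⟨ cong pos count ⟩
      pos (d + n * c₀)                       ≡⟨ cong (λ x → pos d ℤ.+ x) (ℤₚ.pos-* n c₀) ⟩
      pos d ℤ.+ pos n ℤ.* pos c₀                 ∎
      where open ≡-Reasoning

    cross : pos r ℤ.* pos (2 * n * 2) ≡ (pos d ℤ.* pos 2 ℤ.+ num ℤ.* pos (2 * n)) ℤ.* pos 1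
    cross = begin
      pos r ℤ.* pos (2 * n * 2)                      ≡⟨ cong (pos r ℤ.*_) (trans (ℤₚ.pos-* (2 * n) 2) (cong (ℤ._* pos 2) (ℤₚ.pos-* 2 n))) ⟩
      pos r ℤ.* (pos 2 ℤ.* pos n ℤ.* pos 2)                ≡⟨ eq₁ (pos r) (pos n) (pos c₁) (pos c₂) (pos c₃) ⟩
      pos 2 ℤ.* (pos r ℤ.* (pos 2 ℤ.* pos n) ℤ.+ pos n ℤ.* (pos c₁ ℤ.+ pos c₂ ℤ.+ pos c₃)) ℤ.- pos 2 ℤ.* (pos n ℤ.* (pos c₁ ℤ.+ pos c₂ ℤ.+ pos c₃))
        ≡⟨ cong (λ x → pos 2 ℤ.* x ℤ.- pos 2 ℤ.* (pos n ℤ.* (pos c₁ ℤ.+ pos c₂ ℤ.+ pos c₃))) countℤ ⟩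
      pos 2 ℤ.* (pos d ℤ.+ pos n ℤ.* pos c₀) ℤ.- pos 2 ℤ.* (pos n ℤ.* (pos c₁ ℤ.+ pos c₂ ℤ.+ pos c₃))
        ≡⟨ eq₂ (pos d) (pos n) (pos c₀) (pos c₁) (pos c₂) (pos c₃) ⟩
      (pos d ℤ.* pos 2 ℤ.+ num ℤ.* (pos 2 ℤ.* pos n)) ℤ.* pos 1
        ≡⟨ cong (λ x → (pos d ℤ.* pos 2 ℤ.+ num ℤ.* x) ℤ.* pos 1) (sym (ℤₚ.pos-* 2 n)) ⟩
      (pos d ℤ.* pos 2 ℤ.+ num ℤ.* pos (2 * n)) ℤ.* pos 1    ∎
      where
      open ≡-Reasoning
      eq₁ : ∀ r n c₁ c₂ c₃ → r ℤ.* (pos 2 ℤ.* n ℤ.* pos 2) ≡ pos 2 ℤ.* (r ℤ.* (pos 2 ℤ.* n) ℤ.+ n ℤ.* (c₁ ℤ.+ c₂ ℤ.+ c₃)) ℤ.- pos 2 ℤ.* (n ℤ.* (c₁ ℤ.+ c₂ ℤ.+ c₃))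
      eq₁ = ℤ-Solver.solve-∀
      eq₂ : ∀ d n c₀ c₁ c₂ c₃ → pos 2 ℤ.* (d ℤ.+ n ℤ.* c₀) ℤ.- pos 2 ℤ.* (n ℤ.* (c₁ ℤ.+ c₂ ℤ.+ c₃))
            ≡ (d ℤ.* pos 2 ℤ.+ (c₀ ℤ.- c₁ ℤ.- c₂ ℤ.- c₃) ℤ.* (pos 2 ℤ.* n)) ℤ.* pos 1
      eq₂ = ℤ-Solver.solve-∀

  -- Unnormalised rationals are equal when their cross products are, and `cross` is twice the
  -- integer form of `count`.
  count⇒formula : (pos r) ℚ./ 1 ≡ frac (pos d) (2 * n) ℚ.+ frac num 2
  count⇒formula = toℚᵘ-injective (begin
    ℚ.toℚᵘ (ℚ.fromℚᵘ x)                                       ≈⟨ toℚᵘ-fromℚᵘ x ⟩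
    x                                                         ≈⟨ *≡* cross ⟩
    y ℚᵘ.+ z                                                  ≈⟨ ℚᵘₚ.+-cong (toℚᵘ-fromℚᵘ y) (toℚᵘ-fromℚᵘ z) ⟨
    ℚ.toℚᵘ (ℚ.fromℚᵘ y) ℚᵘ.+ ℚ.toℚᵘ (ℚ.fromℚᵘ z)              ≈⟨ toℚᵘ-homo-+ (ℚ.fromℚᵘ y) (ℚ.fromℚᵘ z) ⟨
    ℚ.toℚᵘ (ℚ.fromℚᵘ y ℚ.+ ℚ.fromℚᵘ z)                        ∎)
    where
    open ℚᵘₚ.≃-Reasoning
    x = mkℚᵘ (pos r) 0
    -- The second argument is the denominator less one: 2 * n computes to `suc (n′ + 1 * n)`.
    y = mkℚᵘ (pos d) (n′ + 1 * n)
    z = mkℚᵘ num 1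

open import Data.Integer using (+_)

theorem1p5 : (m n : ℕ) → 3 ≤ m → m ≤ n →
    ∃[ reps ] (IsTransversal m n reps × (+ length reps) ℚ./ 1 ≡ formula m n)
theorem1p5 (suc m′) zero    3≤m ()
theorem1p5 (suc m′) (suc n′) 3≤m m≤n =
  reps ,
  (allX , AllPairs.map (λ ¬o e → ¬o (equiv⇒orbit m n e)) sep ,
   λ xs p → Any.map (orbit⇒equiv m n) (cov (complete c p))) ,
  count⇒formula (length reps) (divisorSum m n) n′ c₀ c₁ c₂ c₃
    (combine-counts m n (length reps) (∑ (upTo m) rotationFixed) _ (divisorSum m n) e c₀ c₁ c₂ c₃
      (trans (burnside c (allX , sep , cov)) (cong (λ t → ∑ (upTo m) rotationFixed + t) reflections≡))
      ∑-rotationFixed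
      (∑-orderTerm {m} {n} (s≤s z≤n) (s≤s z≤n))
      mirrors)
  where
  m = suc m′
  n = suc n′
  c₀ = (m / 2 + (n ∸ m) / 2) C (m / 2)
  c₁ = (n / 2) C m′
  c₂ = (n / 4) C (m / 2)
  c₃ = binomHalf ((n + 2) / 4) m
  open Polygons m n using (transversal; burnside)
  c : Card (IsPolygonTuple m n) _
  c = Oversized.polygons m′ n 3≤m (s≤s z≤n)
  open Rotations m′ n 3≤m (s≤s z≤n) c using (rotationFixed; ∑-rotationFixed)
  T = transversal (All.tabulate (sound c))
  reps = proj₁ T
  allX = proj₁ (proj₂ T)
  sep = proj₁ (proj₂ (proj₂ T))
  cov = proj₂ (proj₂ (proj₂ T))
  RF = reflectionFormula m n 3≤m m≤n c
  e = proj₁ RF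
  reflections≡ = proj₁ (proj₂ RF)
  mirrors = proj₂ (proj₂ RF)
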